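{- The number $M'(n,2)$ of 2-ball multiplex prime juggling patterns of period $n$ satisfies $M'(n,2)\sim\gamma_{M'}2^n$ as $n\to\infty$, where $\gamma_{M'}=\sum_{t=1}^\infty(t+1)q_t$.
   Context: A 2-ball multiplex state is a sequence $\alpha=(\alpha_1,\alpha_2,\dots)$ with $\alpha_i\in\{0,1,2\}$, finitely many nonzero, $\sum_i\alpha_i=2$. There is a transition $\alpha\to\beta$ iff $\alpha_{i+1}\le\beta_i$ for all $i\ge1$. A 2-ball multiplex prime juggling pattern of period $n$ is a directed cycle of length $n$ in this state graph, counted up to cyclic rotation. The sequence $q_t$ is $q_t=\frac12\prod_{i=2}^t\frac{i-1}{2^i-i-1}$ (so $q_1=1/2$). -}

module Defs where

open import Data.Nat as ℕ using (ℕ; zero; suc; _+_; _*_; _∸_; _^_; _≤_; _<_; _≥_; z≤n; s≤s)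
open import Data.Nat.Properties as ℕP using ()
open import Data.Integer using (+_)
open import Data.Rational as ℚ using (ℚ; _/_)
open import Data.Fin using (Fin)
open import Data.Product using (Σ; ∃; _×_; _,_)
open import Relation.Binary.PropositionalEquality using (_≡_; refl; sym; subst)
open import Relation.Nullary using (¬_)

-- 2-ball multiplex states.
-- A state α with α_i ∈ {0,1,2}, Σ α_i = 2, is determined by the
-- positions 1 ≤ a ≤ b of its two balls (a = b means α_a = 2).

State : Set
State = Σ ℕ λ a → Σ ℕ λ b → (1 ≤ a) × (a ≤ b)

δ : ℕ → ℕ → ℕ
δ zero    zero    = 1
δ zero    (suc _) = 0
δ (suc _) zero    = 0
δ (suc m) (suc n) = δ m n

occ : State → ℕ → ℕ
occ (a , b , _) i = δ a i + δ b i

_⇒_ : State → State → Set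
α ⇒ β = ∀ i → 1 ≤ i → occ α (suc i) ≤ occ β i

-- Directed cycles of length n (n ≥ 1) in the state graph, written as
-- n-periodic sequences of states s 0, s 1, … with s i → s (i+1),
-- whose n states s 0,…,s (n-1) are pairwise distinct.

record Cycle (n : ℕ) : Set where
  field
    st       : ℕ → State
    periodic : ∀ i → st (i + n) ≡ st i
    step     : ∀ i → st i ⇒ st (suc i)
    distinct : ∀ i j → i < n → j < n → st i ≡ st j → i ≡ j
open Cycle public

Rot : ∀ {n} → Cycle n → Cycle n → Set
Rot c d = Σ ℕ λ k → ∀ i → st d i ≡ st c (i + k)

CountUpToRot : ℕ → ℕ → Set
CountUpToRot n m =
  Σ (Fin m → Cycle n) λ f →
    (∀ c → ∃ λ i → Rot (f i) c) ×
    (∀ i j → Rot (f i) (f j) → i ≡ j)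

-- q_t = 1/2 ∏_{i=2}^t (i-1)/(2^i - i - 1),  q_1 = 1/2.

private
  pow-bound : ∀ k → suc (k + 3) ≤ 2 ^ (k + 2)
  pow-bound zero    = ℕP.≤-refl
  pow-bound (suc k) =
    subst (_≤ 2 ^ (k + 2) + (2 ^ (k + 2) + 0)) (ℕP.+-comm (suc (k + 3)) 1)
      (ℕP.+-mono-≤ (pow-bound k)
        (ℕP.≤-trans (ℕP.≤-trans (s≤s z≤n) (pow-bound k))
                    (ℕP.m≤m+n (2 ^ (k + 2)) 0)))

-- denominator for i = k + 2 : 2^i - i - 1 = 2^(k+2) ∸ (k+3) > 0
den-nz : ∀ k → ℕ.NonZero (2 ^ (k + 2) ∸ (k + 3))
den-nz k = ℕ.>-nonZero (ℕP.m<n⇒0<n∸m (pow-bound k))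

-- factor (i-1)/(2^i - i - 1) for i = k + 2
factor : ℕ → ℚ
factor k = _/_ (+ (k + 1)) (2 ^ (k + 2) ∸ (k + 3)) {{den-nz k}}

-- q t for t ≥ 1 (q 0 is an unused dummy value)
q : ℕ → ℚ
q zero          = ℚ.0ℚ
q (suc zero)    = ℚ.½
q (suc (suc k)) = q (suc k) ℚ.* factor k

S : ℕ → ℚ
S zero    = ℚ.0ℚ
S (suc t) = S t ℚ.+ (+ (t + 2) / 1) ℚ.* q (suc t)

_/2^_ : ℕ → ℕ → ℚ
m /2^ n = _/_ (+ m) (2 ^ n) {{ℕP.m^n≢0 2 n}}

{-
A state whose lower ball is at position 1 is given by the distance d ≥ 0 of the
other ball; call it the vertex d.  Waiting leads from every state to a vertex, so a
cycle is a cyclic sequence of distinct vertices.  Going from d > 0 to d′ takes d time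
units, or only d − d′ if 0 < d′ < d and the ball is thrown below the other one (a
discounted edge); leaving the vertex 0 takes any positive time.  Cutting a cycle at
its undiscounted edges leaves decreasing chains, each lasting as long as its largest
vertex.

Let b_t(n) count the cycles of length n with t chains that avoid 0.  Deleting the
vertex 1 and lowering all others by one gives, for t ≥ 2,
  b_t(n + t) = (t + 1) b_t(n) + (t − 1) b_{t−1}(n),
since 1 was absent, or at the end of one of the t chains, or a chain of its own; and
b_1(n) = 2^(n−1).  The vertex 0 can be inserted after any of the t chains, with any
positive duration, so
  M′(n,2) = 1 + Σ_t ( b_t(n) + t Σ_{m<n} b_t(m) ).
The numbers 2^n q_t satisfy the same recurrence, hence b_t(n) ≤ 2^n q_t, and the
defect q_t − b_t(n)/2^n is contracted by (t + 1)/2^t ≤ 3/4 and tends to 0.  Summing,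
term t of M′(n,2)/2^n is at most (t + 1) q_t and tends to it.
-}

module Submission where

open import Defs
open import Data.Product using (Σ; ∃; ∃₂; _×_; _,_; proj₁; proj₂)
open import Function using (_∘_)
open import Relation.Binary.PropositionalEquality hiding ([_])

-- Counting up to rotation requires one linear form per cycle. The cut is made after the largest
-- vertex: it occurs only once and no discounted edge can enter it, so the cut falls between two
-- chains. A new lowest vertex goes to the end of a chain, never in front of the largest vertex, so
-- the recurrence holds for the linear words without symmetry factors. Vertices are not actually
-- lowered: a floor `v` rises instead and durations are measured from it. Edges out of 0 have a free
-- duration, which is stored in the vertex 0 itself.
--
-- The constant γ is an infinite series of rationals, so convergence is expressed as closeness to
-- all late partial sums `S t`. Termwise convergence alone would not give this; limit and sum may be
-- interchanged because the dominating terms (t + 1) q_t at least halve from the third one on, so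
-- that one cut-off works for all n.

module Cycles where

  open import Data.Empty using (⊥; ⊥-elim)
  open import Data.Fin using (Fin; zero; suc; splitAt; join; combine; remQuot; toℕ; fromℕ<)
  import Data.Fin.Properties as Finₚ
  open import Data.List using (List; []; _∷_; _∷ʳ_; map)
  open import Data.List.Membership.Propositional using (_∈_)
  open import Data.List.Properties using (∷-injective; ∷-injectiveˡ; ∷-injectiveʳ)
  open import Data.List.Relation.Binary.Permutation.Propositional using (_↭_; ↭-refl; ↭-sym; ↭-trans; prep; swap; ↭⇒↭ₛ)
  open import Data.List.Relation.Binary.Permutation.Propositional.Properties using (All-resp-↭; map⁺; ∷↭∷ʳ)
  import Data.List.Relation.Binary.Permutation.Setoid.Properties as PermSetoid
  open import Data.List.Relation.Unary.All as All using (All; []; _∷_)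
  import Data.List.Relation.Unary.All.Properties as Allₚ
  open import Data.List.Relation.Unary.AllPairs using ([]; _∷_)
  open import Data.List.Relation.Unary.Any using (here; there)
  open import Data.List.Relation.Unary.Unique.Propositional using (Unique)
  open import Data.Nat using (ℕ; zero; suc; _+_; _*_; _∸_; _^_; _<_; _≤_; s≤s; z≤n; _<?_)
  open import Data.Nat.DivMod using
    (_%_; _/_; m≡m%n+[m/n]*n; [m+kn]%n≡m%n; [m+n]%n≡m%n; m%n<n; m<n⇒m%n≡m; n%n≡0; %-distribˡ-+; m%n%n≡m%n)
  open import Data.Nat.Induction using (<-rec)
  import Data.Nat.Properties as ℕₚ
  open import Data.Nat.Tactic.RingSolver using (solve-∀)
  open import Data.Product.Properties using (,-injective; ,-injectiveˡ; ,-injectiveʳ)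
  open import Data.Sum using (_⊎_; inj₁; inj₂; [_,_])
  open import Data.Unit using (⊤; tt)
  open import Relation.Nullary using (¬_; yes; no)

  -- Counting predicates

  -- Only elements of `X` are compared, never proofs of `P`, so `P` may be an existential statement
  -- with many witnesses.
  record Counts {X : Set} (P : X → Set) (m : ℕ) : Set where
    field
      enum     : Fin m → X
      sound    : ∀ i → P (enum i)
      complete : ∀ {x} → P x → ∃ λ i → enum i ≡ x
      inj      : ∀ {i j} → enum i ≡ enum j → i ≡ j

  sum< : ℕ → (ℕ → ℕ) → ℕ
  sum< zero    f = 0
  sum< (suc k) f = sum< k f + f k

  -- The coefficients of x^t times the generating function of f.
  shift : ℕ → (ℕ → ℕ) → ℕ → ℕ
  shift zero    f n       = f n
  shift (suc t) f zero    = 0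
  shift (suc t) f (suc n) = shift t f n

  module _ {X : Set} where

    open Counts

    counts-⇔ : {P Q : X → Set} {m : ℕ} → (∀ {x} → P x → Q x) → (∀ {x} → Q x → P x) →
               Counts P m → Counts Q m
    counts-⇔ to from c = record
      { enum = enum c ; sound = to ∘ sound c ; complete = complete c ∘ from ; inj = inj c }

    counts-∅ : {P : X → Set} → (∀ {x} → ¬ P x) → Counts P 0
    counts-∅ ¬P = record
      { enum = λ () ; sound = λ () ; complete = λ p → ⊥-elim (¬P p) ; inj = λ {} }

    counts-singleton : (x : X) → Counts (x ≡_) 1
    counts-singleton x = record
      { enum = λ _ → x ; sound = λ _ → refl ; complete = λ p → zero , p
      ; inj = λ { {zero} {zero} _ → refl } }

    counts-⊎ : {P Q : X → Set} {m k : ℕ} → (∀ {x} → P x → Q x → ⊥) →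
               Counts P m → Counts Q k → Counts (λ x → P x ⊎ Q x) (m + k)
    counts-⊎ {P} {Q} {m} {k} disjoint cP cQ = record
      { enum     = [ enum cP , enum cQ ] ∘ splitAt m
      ; sound    = sound⊎ ∘ splitAt m
      ; complete = λ p → let (i , eq) = complete⊎ p in
                   join m k i , trans (cong [ enum cP , enum cQ ] (Finₚ.splitAt-join m k i)) eq
      ; inj      = λ {i} {j} eq → trans (sym (Finₚ.join-splitAt m k i))
                     (trans (cong (join m k) (inj⊎ (splitAt m i) (splitAt m j) eq))
                            (Finₚ.join-splitAt m k j)) }
      where
      sound⊎ : ∀ i → P ([ enum cP , enum cQ ] i) ⊎ Q ([ enum cP , enum cQ ] i)
      sound⊎ (inj₁ i) = inj₁ (sound cP i)
      sound⊎ (inj₂ i) = inj₂ (sound cQ i)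
      complete⊎ : ∀ {x} → P x ⊎ Q x → ∃ λ i → [ enum cP , enum cQ ] i ≡ x
      complete⊎ (inj₁ p) = let (i , eq) = complete cP p in inj₁ i , eq
      complete⊎ (inj₂ q) = let (i , eq) = complete cQ q in inj₂ i , eq
      inj⊎ : ∀ i j → [ enum cP , enum cQ ] i ≡ [ enum cP , enum cQ ] j → i ≡ j
      inj⊎ (inj₁ i) (inj₁ j) eq = cong inj₁ (inj cP eq)
      inj⊎ (inj₁ i) (inj₂ j) eq = ⊥-elim (disjoint (sound cP i) (subst Q (sym eq) (sound cQ j)))
      inj⊎ (inj₂ i) (inj₁ j) eq = ⊥-elim (disjoint (sound cP j) (subst Q eq (sound cQ i)))
      inj⊎ (inj₂ i) (inj₂ j) eq = cong inj₂ (inj cQ eq)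

    counts-op : {Y : Set} {P : X → Set} {m k : ℕ} (op : Fin k → X → Y) →
                (∀ {i j x y} → P x → P y → op i x ≡ op j y → i ≡ j × x ≡ y) →
                Counts P m → Counts (λ z → ∃ λ i → ∃ λ x → P x × op i x ≡ z) (k * m)
    counts-op {P = P} {m} {k} op op-inj c = record
      { enum     = λ i → apply (remQuot m i)
      ; sound    = λ i → _ , _ , sound c _ , refl
      ; complete = λ { (i , x , p , refl) → let (j , eq) = complete c p in
                     combine i j , trans (cong apply (Finₚ.remQuot-combine i j)) (cong (op i) eq) }
      ; inj      = λ {i} {j} eq →
                     let (e₁ , e₂) = op-inj (sound c _) (sound c _) eq in
                     trans (sym (Finₚ.combine-remQuot {k} m i))
                       (trans (cong₂ combine e₁ (inj c e₂)) (Finₚ.combine-remQuot {k} m j)) }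
      where
      apply : Fin k × Fin m → _
      apply (i , j) = op i (enum c j)

    counts-sum : {P : ℕ → X → Set} {c : ℕ → ℕ} → (∀ {s t x} → P s x → P t x → s ≡ t) →
                 ∀ k → (∀ t → t < k → Counts (P t) (c t)) → Counts (λ x → ∃ λ t → t < k × P t x) (sum< k c)
    counts-sum disjoint zero cs = counts-∅ λ { (_ , () , _) }
    counts-sum {P} {c} disjoint (suc k) cs = counts-⇔
      [ (λ { (t , t<k , p) → t , ℕₚ.m<n⇒m<1+n t<k , p }) , (λ p → k , ℕₚ.≤-refl , p) ]
      split
      (counts-⊎ (λ { (t , t<k , p) q → ℕₚ.<⇒≢ t<k (disjoint p q) })
        (counts-sum disjoint k (λ t t<k → cs t (ℕₚ.m<n⇒m<1+n t<k))) (cs k ℕₚ.≤-refl))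
      where
      split : ∀ {x} → (∃ λ t → t < suc k × P t x) → (∃ λ t → t < k × P t x) ⊎ P k x
      split (t , s≤s t≤k , p) with ℕₚ.m≤n⇒m<n∨m≡n t≤k
      ... | inj₁ t<k  = inj₁ (t , t<k , p)
      ... | inj₂ refl = inj₂ p

    counts-shift : {P : ℕ → X → Set} {c : ℕ → ℕ} → ∀ t n → (∀ m → n ≡ t + m → Counts (P m) (c m)) →
                   Counts (λ x → ∃ λ m → n ≡ t + m × P m x) (shift t c n)
    counts-shift zero n cs = counts-⇔ (λ p → n , refl , p) (λ { (_ , refl , p) → p }) (cs n refl)
    counts-shift (suc t) zero cs = counts-∅ λ { (_ , () , _) }
    counts-shift (suc t) (suc n) cs = counts-⇔
      (λ { (m , eq , p) → m , cong suc eq , p }) (λ { (m , eq , p) → m , ℕₚ.suc-injective eq , p })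
      (counts-shift t n (λ m eq → cs m (cong suc eq)))

  -- Vertex sequences and their chains

  -- pos e is the vertex e + 1, and zer p the vertex 0 left after p + 1 time units.
  data Vertex : Set where
    pos : ℕ → Vertex
    zer : ℕ → Vertex

  val : Vertex → ℕ
  val (pos e) = suc e
  val (zer p) = 0

  -- The edge into D e is discounted, the edge into N u is not.
  data Step : Set where
    D : ℕ → Step
    N : Vertex → Step

  vertex : Step → Vertex
  vertex (D e) = pos e
  vertex (N u) = u

  sval : Step → ℕ
  sval s = val (vertex s)

  Good : Vertex → List Step → Set
  Good u []        = ⊤
  Good u (D e ∷ L) = suc e < val u × Good (pos e) L
  Good u (N w ∷ L) = Good w L

  chains : List Step → ℕ
  chains []        = 1
  chains (D e ∷ L) = chains L
  chains (N w ∷ L) = suc (chains L)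

  cost : ℕ → Vertex → ℕ
  cost v (pos e) = suc e ∸ v
  cost v (zer p) = suc p

  -- The time needed to run from u through L and back to the start, after lowering all
  -- vertices by v.
  weight : ℕ → Vertex → List Step → ℕ
  weight v u []        = cost v u
  weight v u (D e ∷ L) = (val u ∸ suc e) + weight v (pos e) L
  weight v u (N w ∷ L) = cost v u + weight v w L

  -- Inserts at the end of chain i, for i < chains L.
  insert : Step → ℕ → List Step → List Step
  insert s i       []        = s ∷ []
  insert s i       (D e ∷ L) = D e ∷ insert s i L
  insert s zero    (N w ∷ L) = s ∷ N w ∷ L
  insert s (suc i) (N w ∷ L) = N w ∷ insert s i L

  insert-↭ : ∀ s i L → insert s i L ↭ s ∷ L
  insert-↭ s i       []        = ↭-refl
  insert-↭ s i       (D e ∷ L) = ↭-trans (prep _ (insert-↭ s i L)) (swap _ _ ↭-refl)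
  insert-↭ s zero    (N w ∷ L) = ↭-refl
  insert-↭ s (suc i) (N w ∷ L) = ↭-trans (prep _ (insert-↭ s i L)) (swap _ _ ↭-refl)

  chains-insert-D : ∀ e i L → chains (insert (D e) i L) ≡ chains L
  chains-insert-D e i       []        = refl
  chains-insert-D e i       (D _ ∷ L) = chains-insert-D e i L
  chains-insert-D e zero    (N w ∷ L) = refl
  chains-insert-D e (suc i) (N w ∷ L) = cong suc (chains-insert-D e i L)

  chains-insert-N : ∀ u i L → chains (insert (N u) i L) ≡ suc (chains L)
  chains-insert-N u i       []        = refl
  chains-insert-N u i       (D _ ∷ L) = chains-insert-N u i L
  chains-insert-N u zero    (N w ∷ L) = refl
  chains-insert-N u (suc i) (N w ∷ L) = cong suc (chains-insert-N u i L)

  chains>0 : ∀ L → 1 ≤ chains L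
  chains>0 []        = ℕₚ.≤-refl
  chains>0 (D _ ∷ L) = chains>0 L
  chains>0 (N _ ∷ L) = s≤s z≤n

  -- The insertion takes place before an undiscounted step or at the very end, so only the edge into
  -- the new vertex matters; it may be discounted because that vertex lies below all others.
  good-insert : ∀ {u} s i L → sval s < val u → All (λ r → sval s < sval r) L →
                Good u L → Good u (insert s i L)
  good-insert (D _) i       []        lt _          g       = lt , tt
  good-insert (N _) i       []        lt _          g       = tt
  good-insert s     i       (D e ∷ L) _  (lt ∷ all) (h , g) = h , good-insert s i L lt all g
  good-insert (D _) zero    (N w ∷ L) lt _          g       = lt , g
  good-insert (N _) zero    (N w ∷ L) lt _          g       = g
  good-insert s     (suc i) (N w ∷ L) _  (lt ∷ all) g       = good-insert s i L lt all g

  cost-suc : ∀ {v u} → suc v < val u → cost v u ≡ suc (cost (suc v) u)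
  cost-suc {v} {pos e} (s≤s v<e) = ℕₚ.+-∸-assoc 1 (ℕₚ.<⇒≤ v<e)

  interchange : ∀ a b c → a + (b + c) ≡ b + (a + c)
  interchange = solve-∀

  weight-insert-N : ∀ v u w i L → weight v u (insert (N w) i L) ≡ cost v w + weight v u L
  weight-insert-N v u w i       []         = ℕₚ.+-comm (cost v u) _
  weight-insert-N v u w i       (D e ∷ L)  =
    trans (cong (val u ∸ suc e +_) (weight-insert-N v (pos e) w i L)) (interchange (val u ∸ suc e) (cost v w) _)
  weight-insert-N v u w zero    (N w′ ∷ L) = interchange (cost v u) (cost v w) _
  weight-insert-N v u w (suc i) (N w′ ∷ L) =
    trans (cong (cost v u +_) (weight-insert-N v w′ w i L)) (interchange (cost v u) (cost v w) _)

  cost-split : ∀ {v u} → suc v < val u → (val u ∸ suc v) + cost v (pos v) ≡ cost v u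
  cost-split {v} {u} lt = trans (cong (val u ∸ suc v +_) (ℕₚ.m+n∸n≡m 1 v))
    (trans (ℕₚ.+-comm _ 1) (split u lt))
    where
    split : ∀ u → suc v < val u → suc (val u ∸ suc v) ≡ cost v u
    split (pos e) (s≤s v<e) = sym (ℕₚ.+-∸-assoc 1 (ℕₚ.<⇒≤ v<e))

  -- The new vertex splits the last stretch of its chain: stepping down to `v + 1` and then paying
  -- one unit costs as much as leaving the old end undiscounted.
  weight-insert-D : ∀ {v u} i L → suc v < val u → All (λ r → suc v < sval r) L →
                    weight v u (insert (D v) i L) ≡ weight v u L
  weight-insert-D     i       []        lt _          = cost-split lt
  weight-insert-D {u = u} i (D e ∷ L)   lt (h ∷ all)  = cong (val u ∸ suc e +_) (weight-insert-D i L h all)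
  weight-insert-D {v} {u} zero (N w ∷ L) lt _         =
    trans (sym (ℕₚ.+-assoc (val u ∸ suc v) _ _)) (cong (_+ weight v w L) (cost-split lt))
  weight-insert-D {v} {u} (suc i) (N w ∷ L) lt (h ∷ all) = cong (cost v u +_) (weight-insert-D i L h all)

  -- Lowering every vertex by one shortens each chain by one.
  weight-suc : ∀ {v u} L → suc v < val u → All (λ r → suc v < sval r) L →
               weight v u L ≡ chains L + weight (suc v) u L
  weight-suc []        lt _ = cost-suc lt
  weight-suc {v} {u} (D e ∷ L) lt (h ∷ all) =
    trans (cong (val u ∸ suc e +_) (weight-suc L h all)) (interchange (val u ∸ suc e) (chains L) _)
  weight-suc {v} {u} (N w ∷ L) lt (h ∷ all) =
    trans (cong₂ _+_ (cost-suc lt) (weight-suc L h all)) (cong suc (interchange (cost (suc v) u) (chains L) _))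

  weight>0 : ∀ {v u} L → v < val u → All (λ r → v < sval r) L → Good u L → 0 < weight v u L
  weight>0 {v} {pos e} []     lt _         _       = ℕₚ.m<n⇒0<n∸m lt
  weight>0 (D e ∷ L)  lt (h ∷ all) (_ , g) = ℕₚ.≤-trans (weight>0 L h all g) (ℕₚ.m≤n+m _ _)
  weight>0 (N w ∷ L)  lt (h ∷ all) g = ℕₚ.≤-trans (weight>0 L h all g) (ℕₚ.m≤n+m _ _)

  unique-resp-↭ : {xs ys : List ℕ} → xs ↭ ys → Unique xs → Unique ys
  unique-resp-↭ p = PermSetoid.Unique-resp-↭ (setoid ℕ) (↭⇒↭ₛ p)

  -- The strict upper bound in `range` makes `u` the only largest vertex, so `unique` concerns just
  -- the rest.
  record Struct (k : ℕ) (u : Vertex) (L : List Step) : Set where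
    constructor mkStruct
    field
      k≤top  : k ≤ val u
      good   : Good u L
      unique : Unique (map sval L)
      range  : All (λ s → k ≤ sval s × sval s < val u) L

  module _ {k : ℕ} where

    lower : ∀ {u L} → Struct k u L → All (λ s → k ≤ sval s) L
    lower S = All.map proj₁ (Struct.range S)

    struct-weaken : ∀ {u L} → Struct (suc k) u L → Struct k u L
    struct-weaken (mkStruct a b c d) =
      mkStruct (ℕₚ.<⇒≤ a) b c (All.map (λ { (x , y) → ℕₚ.<⇒≤ x , y }) d)

    struct-insert : ∀ {u L} s i → sval s ≡ k → Struct (suc k) u L → Struct k u (insert s i L)
    struct-insert {u} {L} s i refl S@(mkStruct a b c d) = mkStruct (ℕₚ.<⇒≤ a)
      (good-insert s i L a (All.map proj₁ d) b)
      (unique-resp-↭ (map⁺ sval (↭-sym (insert-↭ s i L)))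
        (Allₚ.map⁺ (All.map (λ x → ℕₚ.<⇒≢ (proj₁ x)) d) ∷ c))
      (All-resp-↭ (↭-sym (insert-↭ s i L))
        ((ℕₚ.≤-refl , a) ∷ All.map (λ { (x , y) → ℕₚ.<⇒≤ x , y }) d))

    least? : ∀ L → All (λ s → k ≤ sval s) L →
             All (λ s → k < sval s) L ⊎ ∃ λ s → s ∈ L × sval s ≡ k
    least? []      []        = inj₁ []
    least? (s ∷ L) (h ∷ all) with ℕₚ.m≤n⇒m<n∨m≡n h | least? L all
    ... | inj₂ eq | _                   = inj₂ (s , here refl , sym eq)
    ... | inj₁ _  | inj₂ (r , r∈L , eq) = inj₂ (r , there r∈L , eq)
    ... | inj₁ lt | inj₁ all′           = inj₁ (lt ∷ all′)

    -- A minimal vertex is never followed by a discounted step.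
    uninsert : ∀ {u s} L → s ∈ L → sval s ≡ k → Good u L → All (λ r → k ≤ sval r) L →
               ∃₂ λ i L₀ → i < chains L₀ × L ≡ insert s i L₀ × Good u L₀
    uninsert (s ∷ [])        (here refl) eq g h = 0 , [] , s≤s z≤n , refl , tt
    uninsert (D _ ∷ N w ∷ L) (here refl) eq g h = 0 , N w ∷ L , s≤s z≤n , refl , proj₂ g
    uninsert (N _ ∷ N w ∷ L) (here refl) eq g h = 0 , N w ∷ L , s≤s z≤n , refl , g
    uninsert (D _ ∷ D e ∷ L) (here refl) refl (_ , lt , _) (_ ∷ h ∷ _) = ⊥-elim (ℕₚ.<⇒≱ lt h)
    uninsert (N _ ∷ D e ∷ L) (here refl) refl (lt , _) (_ ∷ h ∷ _) = ⊥-elim (ℕₚ.<⇒≱ lt h)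
    uninsert (D e ∷ L) (there s∈L) eq (lt , g) (_ ∷ h)
      with i , L₀ , i< , refl , g₀ ← uninsert L s∈L eq g h = i , D e ∷ L₀ , i< , refl , lt , g₀
    uninsert (N w ∷ L) (there s∈L) eq g (_ ∷ h)
      with i , L₀ , i< , refl , g₀ ← uninsert L s∈L eq g h = suc i , N w ∷ L₀ , s≤s i< , refl , g₀

    struct-peel : ∀ {u L} → Struct k u L →
      (val u ≡ k × L ≡ []) ⊎ Struct (suc k) u L ⊎
      (∃ λ s → ∃₂ λ i L₀ → sval s ≡ k × i < chains L₀ × L ≡ insert s i L₀ × Struct (suc k) u L₀)
    struct-peel {u} {L} S@(mkStruct a b c d) with ℕₚ.m≤n⇒m<n∨m≡n a
    struct-peel {u} {[]}    S@(mkStruct a b c d) | inj₂ eq = inj₁ (sym eq , refl)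
    -- A largest vertex equal to the floor leaves no room for a second vertex.
    struct-peel {u} {_ ∷ _} S@(mkStruct a b c ((h , h′) ∷ _)) | inj₂ refl = ⊥-elim (ℕₚ.<⇒≱ h′ h)
    ... | inj₁ lt with least? L (lower S)
    ... | inj₁ all = inj₂ (inj₁ (mkStruct lt b c (All.zip (all , All.map proj₂ d))))
    ... | inj₂ (s , s∈L , eq) with uninsert L s∈L eq b (lower S)
    ... | i , L₀ , i< , refl , g₀
      with unique-resp-↭ (map⁺ sval (insert-↭ s i L₀)) c
         | All-resp-↭ (insert-↭ s i L₀) d
    ... | n ∷ uq | _ ∷ d₀ = inj₂ (inj₂ (s , i , L₀ , eq , i< , refl ,
      mkStruct lt g₀ uq (All.map (λ { (ne , h , h′) → ℕₚ.≤∧≢⇒< h (λ e → ne (trans eq e)) , h′ })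
                                  (All.zip (Allₚ.map⁻ n , d₀)))))

    clash : ∀ {s r} → s ≡ r → sval s ≡ k → k < sval r → ⊥
    clash refl refl = ℕₚ.n≮n _

    -- The inserted step is the only one of value `k`, so its position can be read off. The bounds
    -- on `i` and `j` matter: `insert` sends every index beyond the last chain to the end of the
    -- list.
    insert-injective : ∀ {s s′ i j} L L′ → sval s ≡ k → sval s′ ≡ k →
      All (λ r → k < sval r) L → All (λ r → k < sval r) L′ → i < chains L → j < chains L′ →
      insert s i L ≡ insert s′ j L′ → s ≡ s′ × i ≡ j × L ≡ L′
    insert-injective {i = zero}  {zero}  [] [] _ _ _ _ _ _ refl = refl , refl , refl
    insert-injective {i = suc _}         [] L′ _ _ _ _ (s≤s ()) _ _
    insert-injective {j = suc _}         L [] _ _ _ _ _ (s≤s ()) _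
    insert-injective {i = zero}          [] (D _ ∷ L′) p _ _ (lt ∷ _) _ _ eq = ⊥-elim (clash (∷-injectiveˡ eq) p lt)
    insert-injective {i = zero}  {zero}  [] (N _ ∷ L′) _ _ _ _ _ _ ()
    insert-injective {i = zero}  {suc j} [] (N _ ∷ L′) p _ _ (lt ∷ _) _ _ eq = ⊥-elim (clash (∷-injectiveˡ eq) p lt)
    insert-injective                     (D _ ∷ L) [] _ q (lt ∷ _) _ _ _ eq = ⊥-elim (clash (sym (∷-injectiveˡ eq)) q lt)
    insert-injective {i = i} {j}         (D _ ∷ L) (D _ ∷ L′) p q (_ ∷ h) (_ ∷ h′) i< j< eq
      with refl , eq′ ← ∷-injective eq
      with refl , refl , refl ← insert-injective L L′ p q h h′ i< j< eq′ = refl , refl , refl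
    insert-injective {j = zero}          (D _ ∷ L) (N _ ∷ L′) _ q (lt ∷ _) _ _ _ eq = ⊥-elim (clash (sym (∷-injectiveˡ eq)) q lt)
    insert-injective {j = suc j}         (D _ ∷ L) (N _ ∷ L′) _ _ _ _ _ _ ()
    insert-injective {i = zero}  {zero}  (N _ ∷ L) [] _ _ _ _ _ _ ()
    insert-injective {i = suc i} {zero}  (N _ ∷ L) [] _ q (lt ∷ _) _ _ _ eq = ⊥-elim (clash (sym (∷-injectiveˡ eq)) q lt)
    insert-injective {i = zero}          (N _ ∷ L) (D _ ∷ L′) p _ _ (lt ∷ _) _ _ eq = ⊥-elim (clash (∷-injectiveˡ eq) p lt)
    insert-injective {i = suc i}         (N _ ∷ L) (D _ ∷ L′) _ _ _ _ _ _ ()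
    insert-injective {i = zero}  {zero}  (N _ ∷ L) (N _ ∷ L′) _ _ _ _ _ _ refl = refl , refl , refl
    insert-injective {i = zero}  {suc j} (N _ ∷ L) (N _ ∷ L′) p _ _ (lt ∷ _) _ _ eq = ⊥-elim (clash (∷-injectiveˡ eq) p lt)
    insert-injective {i = suc i} {zero}  (N _ ∷ L) (N _ ∷ L′) _ q (lt ∷ _) _ _ _ eq = ⊥-elim (clash (sym (∷-injectiveˡ eq)) q lt)
    insert-injective {i = suc i} {suc j} (N _ ∷ L) (N _ ∷ L′) p q (_ ∷ h) (_ ∷ h′) (s≤s i<) (s≤s j<) eq
      with refl , eq′ ← ∷-injective eq
      with refl , refl , refl ← insert-injective L L′ p q h h′ i< j< eq′ = refl , refl , refl

  -- The recurrence in the number of chains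

  Path : Set
  Path = Vertex × List Step

  root : ℕ → Path
  root v = pos v , []

  -- Durations are relative to the floor `v`, so the number of valid paths is the same for every
  -- `v`; this replaces lowering the vertices.
  Valid : ℕ → ℕ → ℕ → Path → Set
  Valid v t n (u , L) = Struct (suc v) u L × chains L ≡ t × weight v u L ≡ n

  -- Cycles through a single vertex; the first argument is the number of chains minus one.
  base : ℕ → ℕ → ℕ
  base zero (suc zero) = 1
  base _    _          = 0

  -- H bounds the recursion depth: the value does not depend on it once n ≤ H.
  B : ℕ → ℕ → ℕ → ℕ
  B zero    t       n = 0
  B (suc H) zero    n = 0
  B (suc H) (suc t) n =
    base t n + shift (suc t) (λ m → suc (suc t) * B H (suc t) m + t * B H t m) n

  -- `zero` leaves the vertex `v + 1` out and `suc i` puts it at the end of chain `i`; for `t`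
  -- chains this yields the factor `t + 1`.
  keep : ∀ {t} → ℕ → Fin (suc t) → Path → Path
  keep v zero    x       = x
  keep v (suc i) (u , L) = u , insert (D v) (toℕ i) L

  new : ∀ {t} → Vertex → Fin t → Path → Path
  new w i (u , L) = u , insert (N w) (toℕ i) L

  not-lower : ∀ {k} s i L → sval s ≡ k → All (λ r → k < sval r) (insert s i L) → ⊥
  not-lower s i L refl all = ℕₚ.n≮n _ (All.head (All-resp-↭ (insert-↭ s i L) all))

  toℕ<chains : ∀ {t} L → chains L ≡ t → (i : Fin t) → toℕ i < chains L
  toℕ<chains L refl i = Finₚ.toℕ<n i

  top-insert : ∀ {u w : Vertex} {L L′ : List Step} → (u , L) ≡ (w , L′) → u ≡ w × L ≡ L′
  top-insert refl = refl , refl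

  module _ {v t m : ℕ} where

    keep-injective : ∀ {i j : Fin (suc t)} {x y} → Valid (suc v) t m x → Valid (suc v) t m y →
                     keep v i x ≡ keep v j y → i ≡ j × x ≡ y
    keep-injective {zero}  {zero}  _ _ eq = refl , eq
    keep-injective {zero}  {suc j} {y = y} (S , _) _ refl = ⊥-elim (not-lower (D v) (toℕ j) (proj₂ y) refl (lower S))
    keep-injective {suc i} {zero} {x = x} _ (S , _) refl = ⊥-elim (not-lower (D v) (toℕ i) (proj₂ x) refl (lower S))
    keep-injective {suc i} {suc j} {u , L} {w , L′} (S , c , _) (S′ , c′ , _) eq
      with refl , eq′ ← top-insert eq
      with _ , e , refl ← insert-injective L L′ refl refl (lower S) (lower S′)
                            (toℕ<chains L c i) (toℕ<chains L′ c′ j) eq′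
      = cong suc (Finₚ.toℕ-injective e) , refl

  new-injective : ∀ {w w′ v t t′ m m′} {i : Fin t} {j : Fin t′} {x y} → val w ≡ v → val w′ ≡ v →
    Valid v t m x → Valid v t′ m′ y → new w i x ≡ new w′ j y → w ≡ w′ × toℕ i ≡ toℕ j × x ≡ y
  new-injective {i = i} {j} {u , L} {u′ , L′} p q (S , c , _) (S′ , c′ , _) eq
    with refl , eq′ ← top-insert eq
    with refl , e , refl ← insert-injective L L′ p q (lower S) (lower S′)
                             (toℕ<chains L c i) (toℕ<chains L′ c′ j) eq′
    = refl , e , refl

  Kept : ℕ → ℕ → ℕ → Path → Set
  Kept v t m z = ∃ λ (i : Fin (suc t)) → ∃ λ x → Valid (suc v) t m x × keep v i x ≡ z

  Added : Vertex → ℕ → ℕ → ℕ → Path → Set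
  Added w v t m z = ∃ λ (i : Fin t) → ∃ λ x → Valid v t m x × new w i x ≡ z

  -- The summands of the recurrence for `suc t` chains: a single vertex, a lowest vertex whose
  -- removal keeps the number of chains (or which is absent), and a lowest vertex forming its own
  -- chain.
  Peeled : ℕ → ℕ → ℕ → Path → Set
  Peeled v t n z = ((t ≡ 0 × n ≡ 1) × root v ≡ z) ⊎
    ∃ λ m → n ≡ suc t + m × (Kept v (suc t) m z ⊎ Added (pos v) (suc v) t m z)

  kept-valid : ∀ {v t m z} → Kept v t m z → Valid v t (t + m) z
  kept-valid (zero , (u , L) , (S , refl , refl) , refl) =
    struct-weaken S , refl , weight-suc L (Struct.k≤top S) (lower S)
  kept-valid {v} (suc i , (u , L) , (S , refl , refl) , refl) =
    struct-insert (D v) (toℕ i) refl S , chains-insert-D v (toℕ i) L ,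
    trans (weight-insert-D (toℕ i) L (Struct.k≤top S) (lower S)) (weight-suc L (Struct.k≤top S) (lower S))

  added-valid : ∀ {v t m z} → Added (pos v) (suc v) t m z → Valid v (suc t) (suc t + m) z
  added-valid {v} (i , (u , L) , (S , refl , refl) , refl) =
    struct-insert (N (pos v)) (toℕ i) refl S , chains-insert-N (pos v) (toℕ i) L ,
    trans (weight-insert-N v u (pos v) (toℕ i) L)
          (cong₂ _+_ (ℕₚ.m+n∸n≡m 1 v) (weight-suc L (Struct.k≤top S) (lower S)))

  peeled-valid : ∀ {v t n z} → Peeled v t n z → Valid v (suc t) n z
  peeled-valid {v} (inj₁ ((refl , refl) , refl)) =
    mkStruct ℕₚ.≤-refl tt [] [] , refl , ℕₚ.m+n∸n≡m 1 v
  peeled-valid (inj₂ (m , refl , inj₁ k)) = kept-valid k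
  peeled-valid (inj₂ (m , refl , inj₂ k)) = added-valid k

  valid-peeled : ∀ {v t n z} → Valid v (suc t) n z → Peeled v t n z
  valid-peeled {v} {z = u , L} (S , c , e) with struct-peel S
  valid-peeled {v} {z = pos _ , _} (S , refl , refl) | inj₁ (refl , refl) =
    inj₁ ((refl , ℕₚ.m+n∸n≡m 1 v) , refl)
  valid-peeled {v} {z = u , L} (S , c , refl) | inj₂ (inj₁ S′) = inj₂ (weight (suc v) u L ,
    trans (weight-suc L (Struct.k≤top S′) (lower S′)) (cong (_+ weight (suc v) u L) c) ,
    inj₁ (zero , (u , L) , (S′ , c , refl) , refl))
  valid-peeled {v} {z = u , _} (S , c , refl) | inj₂ (inj₂ (D e , i , L , refl , i< , refl , S′)) =
    inj₂ (weight (suc v) u L ,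
      trans (trans (weight-insert-D i L (Struct.k≤top S′) (lower S′)) (weight-suc L (Struct.k≤top S′) (lower S′)))
            (cong (_+ weight (suc v) u L) c′) ,
      inj₁ (suc (fromℕ< (ℕₚ.<-≤-trans i< (ℕₚ.≤-reflexive c′))) , (u , L) , (S′ , c′ , refl) ,
            cong (λ i → u , insert (D v) i L) (Finₚ.toℕ-fromℕ< _)))
    where
    c′ = trans (sym (chains-insert-D v i L)) c
  valid-peeled {v} {z = u , _} (S , c , refl) | inj₂ (inj₂ (N (pos e) , i , L , refl , i< , refl , S′)) =
    inj₂ (weight (suc v) u L ,
      trans (weight-insert-N v u (pos v) i L)
        (cong₂ _+_ (ℕₚ.m+n∸n≡m 1 v)
          (trans (weight-suc L (Struct.k≤top S′) (lower S′)) (cong (_+ weight (suc v) u L) c′))) ,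
      inj₂ (fromℕ< (ℕₚ.<-≤-trans i< (ℕₚ.≤-reflexive c′)) , (u , L) , (S′ , c′ , refl) ,
            cong (λ i → u , insert (N (pos v)) i L) (Finₚ.toℕ-fromℕ< _)))
    where
    c′ = ℕₚ.suc-injective (trans (sym (chains-insert-N (pos v) i L)) c)

  -- The vertex `v + 1` is absent or entered by a discounted edge on one side, and entered by an
  -- undiscounted edge on the other.
  kept-added : ∀ {v t m m′ z} → Kept v (suc t) m z → Added (pos v) (suc v) t m′ z → ⊥
  kept-added {v} (zero , _ , (S , _) , refl) (i , (u , L) , _ , refl) =
    not-lower (N (pos v)) (toℕ i) L refl (lower S)
  kept-added {v} (suc j , (u , L) , (S , c , _) , refl) (i , (u′ , L′) , (S′ , c′ , _) , eq)
    with () , _ ← insert-injective L′ L refl refl (lower S′) (lower S) (toℕ<chains L′ c′ i) (toℕ<chains L c j)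
                    (proj₂ (top-insert eq))

  base-rest : ∀ {v t n} {z : Path} → root v ≡ z →
              (∃ λ m → n ≡ suc t + m × (Kept v (suc t) m z ⊎ Added (pos v) (suc v) t m z)) → ⊥
  base-rest refl (m , _ , inj₁ (zero , _ , (S , _) , refl)) = ℕₚ.n≮n _ (Struct.k≤top S)
  base-rest refl (m , _ , inj₁ (suc i , (u , L) , (S , _) , eq)) with refl , _ ← top-insert eq = ℕₚ.n≮n _ (Struct.k≤top S)
  base-rest refl (m , _ , inj₂ (i , (u , L) , (S , _) , eq)) with refl , _ ← top-insert eq = ℕₚ.n≮n _ (Struct.k≤top S)

  counts-base : ∀ v t n → Counts (λ z → (t ≡ 0 × n ≡ 1) × root v ≡ z) (base t n)
  counts-base v zero (suc zero) = counts-⇔ (λ p → (refl , refl) , p) proj₂ (counts-singleton _)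
  counts-base v zero    zero          = counts-∅ λ { ((_ , ()) , _) }
  counts-base v zero    (suc (suc n)) = counts-∅ λ { ((_ , ()) , _) }
  counts-base v (suc t) n             = counts-∅ λ { ((() , _) , _) }

  -- Induction on `H` with `v` left free, since peeling passes to the floor `suc v`. The weight
  -- drops with every peeling and is never zero, which settles the case `H = 0`.
  counts-valid : ∀ H v t n → n ≤ H → Counts (Valid v t n) (B H t n)
  counts-valid zero    v t       .0 z≤n = counts-∅
    λ { {u , L} (S , _ , e) → ℕₚ.<⇒≢ (weight>0 L (Struct.k≤top S) (lower S) (Struct.good S)) (sym e) }
  counts-valid (suc H) v zero    n n≤H = counts-∅
    λ { {u , L} (S , c , _) → ℕₚ.<⇒≢ (chains>0 L) (sym c) }
  counts-valid (suc H) v (suc t) n n≤H = counts-⇔ peeled-valid valid-peeled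
    (counts-⊎ (base-rest ∘ proj₂) (counts-base v t n) (counts-shift (suc t) n λ m eq →
      counts-⊎ kept-added
        (counts-op (keep v) keep-injective (counts-valid H (suc v) (suc t) m (m≤H m eq)))
        (counts-op (new (pos v)) (λ p q e → let (_ , e₁ , e₂) = new-injective refl refl p q e in Finₚ.toℕ-injective e₁ , e₂)
                   (counts-valid H (suc v) t m (m≤H m eq)))))
    where
    m≤H : ∀ m → n ≡ suc t + m → m ≤ H
    m≤H m refl = ℕₚ.≤-trans (ℕₚ.m≤n+m m t) (ℕₚ.≤-pred n≤H)

  -- Cycles through the vertex 0

  Full : ℕ → Path → Set
  Full n (u , L) = Struct 0 u L × weight 0 u L ≡ n

  fullCount : ℕ → ℕ
  fullCount n = 1 + (sum< n (λ t → B n (suc t) n) + sum< n (λ t → sum< n (λ m → suc t * B n (suc t) m)))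

  -- Each chain lasts at least one unit; hence the sums over the number of chains may stop at `n`.
  chains≤weight : ∀ {u} L → 0 < val u → All (λ s → 0 < sval s) L → chains L ≤ weight 0 u L
  chains≤weight {pos _} []        _ _         = s≤s z≤n
  chains≤weight         (D _ ∷ L) _ (h ∷ all) = ℕₚ.≤-trans (chains≤weight L h all) (ℕₚ.m≤n+m _ _)
  chains≤weight {pos _} (N _ ∷ L) _ (h ∷ all) = s≤s (ℕₚ.≤-trans (chains≤weight L h all) (ℕₚ.m≤n+m _ _))

  chains-suc : ∀ L → ∃ λ t → chains L ≡ suc t
  chains-suc L = chains L ∸ 1 , sym (ℕₚ.m+[n∸m]≡n (chains>0 L))

  -- The other vertices take `m` units, which leaves `n - m` for the edge out of 0; as `zer p` lasts
  -- `p + 1`, the index is `n ∸ suc m`.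
  Zeroed : ℕ → ℕ → ℕ → Path → Set
  Zeroed n t m = Added (zer (n ∸ suc m)) 0 (suc t) m

  FullSplit : ℕ → Path → Set
  FullSplit n z = (zer (n ∸ 1) , []) ≡ z ⊎
    ((∃ λ t → t < n × Valid 0 (suc t) n z) ⊎ ∃ λ t → t < n × ∃ λ m → m < n × Zeroed n t m z)

  split-full : ∀ {n z} → 0 < n → FullSplit n z → Full n z
  split-full {suc n} _ (inj₁ refl) = mkStruct z≤n tt [] [] , refl
  split-full _ (inj₂ (inj₁ (_ , _ , S , _ , e))) = struct-weaken S , e
  split-full {n} _ (inj₂ (inj₂ (t , _ , m , m<n , i , (u , L) , (S , _ , refl) , refl))) =
    struct-insert (N w) (toℕ i) refl S , trans (weight-insert-N 0 u w (toℕ i) L) (eq m<n)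
    where
    w = zer (n ∸ suc m)
    eq : ∀ {n m} → m < n → suc (n ∸ suc m) + m ≡ n
    eq {n} {m} m<n = trans (sym (ℕₚ.+-suc (n ∸ suc m) m)) (ℕₚ.m∸n+n≡m m<n)

  full-split : ∀ {n z} → Full n z → FullSplit n z
  full-split {n} {u , L} (S , e) with struct-peel S
  full-split {n} {zer p , _} (S , refl) | inj₁ (_ , refl) = inj₁ refl
  full-split {n} {u , L} (S , e) | inj₂ (inj₁ S′) =
    let (t , c) = chains-suc L ; le = chains≤weight L (Struct.k≤top S′) (lower S′) in
    inj₂ (inj₁ (t , ℕₚ.≤-trans (ℕₚ.≤-reflexive (sym c)) (ℕₚ.≤-trans le (ℕₚ.≤-reflexive e)) , S′ , c , e))
  full-split {n} {u , _} (S , refl) | inj₂ (inj₂ (N (zer p) , i , L , eq , i< , refl , S′)) =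
    inj₂ (inj₂ (t , ℕₚ.<-trans (ℕₚ.≤-trans (ℕₚ.≤-reflexive (sym c)) le) m< , weight 0 u L , m< ,
      fromℕ< i<t , (u , L) , (S′ , c , refl) ,
      cong₂ (λ q i → u , insert (N (zer q)) i L) (trans (cong (_∸ suc (weight 0 u L)) w≡) p≡) (Finₚ.toℕ-fromℕ< i<t)))
    where
    t = proj₁ (chains-suc L)
    c = proj₂ (chains-suc L)
    i<t = ℕₚ.≤-trans i< (ℕₚ.≤-reflexive c)
    le = chains≤weight L (Struct.k≤top S′) (lower S′)
    w≡ = weight-insert-N 0 u (zer p) i L
    m< : weight 0 u L < weight 0 u (insert (N (zer p)) i L)
    m< = ℕₚ.≤-trans (s≤s (ℕₚ.m≤n+m (weight 0 u L) p)) (ℕₚ.≤-reflexive (sym w≡))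
    p≡ = ℕₚ.m+n∸n≡m p (weight 0 u L)

  counts-full : ∀ n → 0 < n → Counts (Full n) (fullCount n)
  counts-full n 0<n = counts-⇔ (split-full 0<n) full-split
    (counts-⊎ lone-rest (counts-singleton _)
      (counts-⊎ valid-zeroed
        (counts-sum (λ { (_ , c , _) (_ , c′ , _) → ℕₚ.suc-injective (trans (sym c) c′) }) n
          (λ t _ → counts-valid n 0 (suc t) n ℕₚ.≤-refl))
        (counts-sum t-disjoint n (λ t _ → counts-sum m-disjoint n (λ m m<n →
          counts-op (new (zer (n ∸ suc m)))
            (λ p q e → let (_ , e₁ , e₂) = new-injective refl refl p q e in Finₚ.toℕ-injective e₁ , e₂)
            (counts-valid n 0 (suc t) m (ℕₚ.<⇒≤ m<n)))))))
    where
    zeroed-unique : ∀ {s t l m z} → Zeroed n s l z → Zeroed n t m z → s ≡ t × l ≡ m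
    zeroed-unique (i , _ , V , refl) (j , _ , V′ , eq)
      with _ , _ , refl ← new-injective {i = i} {j} refl refl V V′ (sym eq)
      = let (_ , c , e) = V ; (_ , c′ , e′) = V′ in
        ℕₚ.suc-injective (trans (sym c) c′) , trans (sym e) e′
    m-disjoint : ∀ {t l m z} → Zeroed n t l z → Zeroed n t m z → l ≡ m
    m-disjoint p q = proj₂ (zeroed-unique p q)
    t-disjoint : ∀ {s t z} → (∃ λ m → m < n × Zeroed n s m z) → (∃ λ m → m < n × Zeroed n t m z) → s ≡ t
    t-disjoint (_ , _ , p) (_ , _ , q) = proj₁ (zeroed-unique p q)
    valid-zeroed : ∀ {z} → (∃ λ t → t < n × Valid 0 (suc t) n z) →
                   (∃ λ t → t < n × ∃ λ m → m < n × Zeroed n t m z) → ⊥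
    valid-zeroed (_ , _ , S , _) (_ , _ , _ , _ , i , (u , L) , _ , refl) =
      not-lower (N (zer _)) (toℕ i) L refl (lower S)
    lone-rest : ∀ {z} → (zer (n ∸ 1) , []) ≡ z →
      ((∃ λ t → t < n × Valid 0 (suc t) n z) ⊎ ∃ λ t → t < n × ∃ λ m → m < n × Zeroed n t m z) → ⊥
    lone-rest refl (inj₁ (_ , _ , S , _)) = ℕₚ.n≮0 (Struct.k≤top S)
    lone-rest refl (inj₂ (_ , _ , _ , _ , _ , _ , (S , _) , eq)) with refl , _ ← top-insert eq = ℕₚ.n≮0 (Struct.k≤top S)

  -- State sequences

  δ-refl : ∀ n → δ n n ≡ 1
  δ-refl zero    = refl
  δ-refl (suc n) = δ-refl n

  δ-≡ : ∀ m n → 1 ≤ δ m n → m ≡ n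
  δ-≡ zero    zero    _ = refl
  δ-≡ (suc m) (suc n) h = cong suc (δ-≡ m n h)

  δ≤1 : ∀ m n → δ m n ≤ 1
  δ≤1 zero    zero    = s≤s z≤n
  δ≤1 zero    (suc n) = z≤n
  δ≤1 (suc m) zero    = z≤n
  δ≤1 (suc m) (suc n) = δ≤1 m n

  -- The state with balls at positions a + 1 and a + 1 + e, so that mk (0 , y) is the vertex y.
  mk : ℕ × ℕ → State
  mk (a , e) = suc a , suc a + e , s≤s z≤n , ℕₚ.m≤m+n (suc a) e

  coords : State → ℕ × ℕ
  coords (a , b , _) = a ∸ 1 , b ∸ a

  coords-mk : ∀ x → coords (mk x) ≡ x
  coords-mk (a , e) = cong (a ,_) (ℕₚ.m+n∸m≡n a e)

  mk-coords : ∀ s → mk (coords s) ≡ s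
  mk-coords (suc a , b , s≤s z≤n , a≤b) = lemma (ℕₚ.m+[n∸m]≡n a≤b) _ _
    where
    lemma : ∀ {c} → c ≡ b → (p : suc a ≤ c) (p′ : suc a ≤ b) →
            _≡_ {A = State} (suc a , c , s≤s z≤n , p) (suc a , b , s≤s z≤n , p′)
    lemma refl p p′ = cong (λ p → suc a , b , s≤s z≤n , p) (ℕₚ.≤-irrelevant p p′)

  mk-injective : ∀ {x y} → mk x ≡ mk y → x ≡ y
  mk-injective {x} {y} eq = trans (sym (coords-mk x)) (trans (cong coords eq) (coords-mk y))

  -- For y > 0 the ball at height y survives and becomes the lower or the upper one.
  Throw : ℕ → ℕ → ℕ → Set
  Throw y w e = y ≡ 0 ⊎ (y ≡ suc w ⊎ y ≡ suc w + e)

  _↝_ : ℕ × ℕ → ℕ × ℕ → Set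
  (suc a , e) ↝ y       = (a , e) ≡ y
  (zero  , y) ↝ (w , e) = Throw y w e

  ↝⇒⇒ : ∀ x y → x ↝ y → mk x ⇒ mk y
  ↝⇒⇒ (suc a , e) y refl i _ = ℕₚ.≤-refl
  ↝⇒⇒ (zero , e) (w , e′) (inj₁ refl)        (suc i) _ = z≤n
  ↝⇒⇒ (zero , e) (w , e′) (inj₂ (inj₁ refl)) (suc i) _ = ℕₚ.m≤m+n _ _
  ↝⇒⇒ (zero , e) (w , e′) (inj₂ (inj₂ refl)) (suc i) _ = ℕₚ.m≤n+m _ _

  -- Both sides have total two, so domination at every position forces equality.
  two-balls : ∀ a e w e′ → (∀ i → δ a i + δ (a + e) i ≤ δ w i + δ (w + e′) i) → (a , e) ≡ (w , e′)
  two-balls zero e zero e′ h = cong (0 ,_) (sym (δ-≡ e′ e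
    (subst (_≤ δ e′ e) (δ-refl e) (ℕₚ.+-cancelˡ-≤ (δ 0 e) _ _ (h e)))))
  two-balls zero e (suc w) e′ h with () ← h 0
  -- Both left balls are away from 0 but only one right ball can be, so the left balls coincide at a
  -- place where the right side is at most one.
  two-balls (suc a) e zero e′ h = ⊥-elim (contra e eq h)
    where
    at : ∀ i → 1 ≤ δ (suc a) (suc i) + δ (suc a + e) (suc i) → e′ ≡ suc i
    at i le = δ-≡ e′ (suc i) (ℕₚ.≤-trans le (h (suc i)))
    e₁ : e′ ≡ suc a
    e₁ = at a (ℕₚ.≤-trans (ℕₚ.≤-reflexive (sym (δ-refl a))) (ℕₚ.m≤m+n _ _))
    e₂ : e′ ≡ suc a + e
    e₂ = at (a + e) (ℕₚ.≤-trans (ℕₚ.≤-reflexive (sym (δ-refl (a + e)))) (ℕₚ.m≤n+m _ _))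
    eq : e ≡ 0
    eq = ℕₚ.+-cancelˡ-≡ (suc a) e 0 (trans (trans (sym e₂) e₁) (sym (ℕₚ.+-identityʳ (suc a))))
    contra : ∀ e → e ≡ 0 → (∀ i → δ (suc a) i + δ (suc a + e) i ≤ δ 0 i + δ e′ i) → ⊥
    contra .0 refl h with le ← h (suc a) rewrite ℕₚ.+-identityʳ a | δ-refl a = ℕₚ.<⇒≱ le (δ≤1 e′ (suc a))
  two-balls (suc a) e (suc w) e′ h with refl ← two-balls a e w e′ (h ∘ suc) = refl

  mk-↝ : ∀ x y → mk x ⇒ mk y → x ↝ y
  mk-↝ (suc a , e) (w , e′) h = two-balls a e w e′ (λ i → h (suc i) (s≤s z≤n))
  mk-↝ (zero , zero)  (w , e′) h = inj₁ refl
  mk-↝ (zero , suc e) (w , e′) h with δ w e in eq | h (suc e) (s≤s z≤n)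
  ... | suc _ | _  = inj₂ (inj₁ (cong suc (sym (δ-≡ w e (ℕₚ.≤-trans (s≤s z≤n) (ℕₚ.≤-reflexive (sym eq)))))))
  ... | zero  | le = inj₂ (inj₂ (cong suc (sym (δ-≡ (w + e′) e (ℕₚ.≤-trans (ℕₚ.≤-reflexive (sym (δ-refl e))) le)))))

  ⇒⇒↝ : ∀ {s s′} → s ⇒ s′ → coords s ↝ coords s′
  ⇒⇒↝ {s} {s′} h = mk-↝ _ _ (subst₂ _⇒_ (sym (mk-coords s)) (sym (mk-coords s′)) h)

  -- Runs of waiting states

  Seg : Set
  Seg = ℕ × ℕ

  total : List Seg → ℕ
  total []            = 0
  total ((w , e) ∷ S) = suc w + total S

  ends : List Seg → List ℕ
  ends = map proj₂

  -- The vertex `y` precedes the first run and `x` ends the last one. Only the throws between runs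
  -- carry a condition, since waiting is forced.
  Adm : ℕ → List Seg → ℕ → Set
  Adm y []            x = y ≡ x
  Adm y ((w , e) ∷ S) x = Throw y w e × Adm e S x

  -- Segment (w , e) stands for the run (w , e), (w-1 , e), …, (0 , e).
  trace : List Seg → ℕ → ℕ × ℕ
  trace []                j       = 0 , 0
  trace ((w , e) ∷ S)     zero    = w , e
  trace ((zero , e) ∷ S)  (suc j) = trace S j
  trace ((suc w , e) ∷ S) (suc j) = trace ((w , e) ∷ S) j

  trace-step : ∀ {x} w e S j → Adm e S x → suc j < suc w + total S →
               trace ((w , e) ∷ S) j ↝ trace ((w , e) ∷ S) (suc j)
  trace-step zero    e []      zero    adm (s≤s ())
  trace-step zero    e (_ ∷ S) zero    adm _         = proj₁ adm
  trace-step zero    e []      (suc j) adm (s≤s ())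
  trace-step zero    e ((w , e′) ∷ S) (suc j) (_ , adm) (s≤s lt) = trace-step w e′ S j adm lt
  trace-step (suc w) e S       zero    adm _         = refl
  trace-step (suc w) e S       (suc j) adm (s≤s lt)  = trace-step w e S j adm lt

  trace-last : ∀ {x} w e S j → Adm e S x → suc j ≡ suc w + total S → trace ((w , e) ∷ S) j ≡ (0 , x)
  trace-last zero    e []             zero    refl      eq   = refl
  trace-last zero    e ((w , e′) ∷ S) (suc j) (_ , adm) eq   = trace-last w e′ S j adm (ℕₚ.suc-injective eq)
  trace-last (suc w) e S              (suc j) adm       eq   = trace-last w e S j adm (ℕₚ.suc-injective eq)
  trace-last zero    e ((w , e′) ∷ S) zero    _         ()
  trace-last (suc w) e S              zero    _         ()

  trace-ends : ∀ S j → j < total S → proj₂ (trace S j) ∈ ends S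
  trace-ends ((w , e) ∷ S)     zero    _        = here refl
  trace-ends ((zero , e) ∷ S)  (suc j) (s≤s lt) = there (trace-ends S j lt)
  trace-ends ((suc w , e) ∷ S) (suc j) (s≤s lt) with trace-ends ((w , e) ∷ S) j lt
  ... | here eq = here eq
  ... | there m = there m

  trace-decreasing : ∀ w e S j → j < suc w + total S → trace ((w , e) ∷ S) j ≡ (suc w , e) → e ∈ ends S
  trace-decreasing w e S j lt eq = go w j lt eq ℕₚ.≤-refl
    where
    go : ∀ w′ j → j < suc w′ + total S → trace ((w′ , e) ∷ S) j ≡ (suc w , e) → w′ ≤ w → e ∈ ends S
    go w′       zero    _        eq le = ⊥-elim (ℕₚ.<⇒≢ (s≤s le) (proj₁ (,-injective eq)))
    go zero     (suc j) (s≤s lt) eq le = subst (_∈ ends S) (proj₂ (,-injective eq)) (trace-ends S j lt)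
    go (suc w′) (suc j) (s≤s lt) eq le = go w′ j lt eq (ℕₚ.≤-trans (ℕₚ.n≤1+n w′) le)

  -- The second coordinate of a state is the end of its run and the first one its place in that run,
  -- so distinct ends give distinct states.
  trace-injective : ∀ S i j → Unique (ends S) → i < total S → j < total S → trace S i ≡ trace S j → i ≡ j
  trace-injective ((w , e) ∷ S) zero zero uq _ _ eq = refl
  trace-injective ((zero , e) ∷ S) zero (suc j) (n ∷ _) _ (s≤s lt) eq =
    ⊥-elim (Allₚ.All¬⇒¬Any n (subst (_∈ ends S) (sym (proj₂ (,-injective eq))) (trace-ends S j lt)))
  trace-injective ((zero , e) ∷ S) (suc i) zero (n ∷ _) (s≤s lt) _ eq =
    ⊥-elim (Allₚ.All¬⇒¬Any n (subst (_∈ ends S) (proj₂ (,-injective eq)) (trace-ends S i lt)))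
  trace-injective ((zero , e) ∷ S) (suc i) (suc j) (_ ∷ uq) (s≤s i<) (s≤s j<) eq =
    cong suc (trace-injective S i j uq i< j< eq)
  trace-injective ((suc w , e) ∷ S) zero (suc j) (n ∷ _) _ (s≤s lt) eq =
    ⊥-elim (Allₚ.All¬⇒¬Any n (trace-decreasing w e S j lt (sym eq)))
  trace-injective ((suc w , e) ∷ S) (suc i) zero (n ∷ _) (s≤s lt) _ eq =
    ⊥-elim (Allₚ.All¬⇒¬Any n (trace-decreasing w e S i lt eq))
  trace-injective ((suc w , e) ∷ S) (suc i) (suc j) (n ∷ uq) (s≤s i<) (s≤s j<) eq =
    cong suc (trace-injective ((w , e) ∷ S) i j (n ∷ uq) i< j< eq)

  trace-skip : ∀ w e S j → trace ((w , e) ∷ S) (suc w + j) ≡ trace S j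
  trace-skip zero    e S j = refl
  trace-skip (suc w) e S j = trace-skip w e S j

  trace-run : ∀ w e S → trace ((w , e) ∷ S) w ≡ (0 , e)
  trace-run zero    e S = refl
  trace-run (suc w) e S = trace-run w e S

  ends-trace : ∀ S {e} → e ∈ ends S → ∃ λ j → j < total S × trace S j ≡ (0 , e)
  ends-trace ((w , e) ∷ S) (here refl) = w , ℕₚ.m≤m+n _ _ , trace-run w e S
  ends-trace ((w , e) ∷ S) (there m) = let (j , lt , eq) = ends-trace S m in
    suc w + j , ℕₚ.+-monoʳ-< (suc w) lt , trans (trace-skip w e S j) eq

  -- Every end `e` occurs as the state `(0 , e)` of the trace, so a repeated end would repeat a
  -- state.
  ends-unique : ∀ S → (∀ i j → i < total S → j < total S → trace S i ≡ trace S j → i ≡ j) → Unique (ends S)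
  ends-unique [] inj = []
  ends-unique ((w , e) ∷ S) inj = Allₚ.¬Any⇒All¬ _ fresh ∷ ends-unique S λ i j i< j< eq →
      ℕₚ.+-cancelˡ-≡ (suc w) i j (inj _ _ (ℕₚ.+-monoʳ-< (suc w) i<) (ℕₚ.+-monoʳ-< (suc w) j<)
        (trans (trace-skip w e S i) (trans eq (sym (trace-skip w e S j)))))
    where
    fresh : ¬ (e ∈ ends S)
    fresh m = let (j , lt , eq) = ends-trace S m in
      ℕₚ.<⇒≢ (s≤s (ℕₚ.m≤m+n w j)) (inj w (suc w + j) (ℕₚ.m≤m+n _ _) (ℕₚ.+-monoʳ-< (suc w) lt)
        (trans (trace-run w e S) (sym (trans (trace-skip w e S j) eq))))

  -- A state `(0 , y)` is a run by itself, and a waiting state lengthens the run that follows it.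
  -- The empty case is a default that a complete trace never reaches.
  prepend : ℕ × ℕ → List Seg → List Seg
  prepend (zero  , y) S       = (zero , y) ∷ S
  prepend (suc a , y) []      = []
  prepend (suc a , y) (_ ∷ S) = (suc a , y) ∷ S

  segments : (ℕ → ℕ × ℕ) → ℕ → List Seg
  segments f zero    = []
  segments f (suc r) = prepend (f 0) (segments (f ∘ suc) r)

  segments-cong : ∀ {f g} r → (∀ j → j < r → f j ≡ g j) → segments f r ≡ segments g r
  segments-cong zero    h = refl
  segments-cong (suc r) h = cong₂ prepend (h 0 (s≤s z≤n)) (segments-cong r (λ j lt → h (suc j) (s≤s lt)))

  segments-trace : ∀ S → segments (trace S) (total S) ≡ S
  segments-trace []            = refl
  segments-trace ((w , e) ∷ S) = go w
    where
    go : ∀ w → segments (trace ((w , e) ∷ S)) (suc w + total S) ≡ (w , e) ∷ S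
    go zero    = cong ((zero , e) ∷_) (segments-trace S)
    go (suc w) = cong (prepend (suc w , e)) (go w)

  -- The pair `v` is read both as the current state and as the run starting there.
  record Parsed (v : ℕ × ℕ) (f : ℕ → ℕ × ℕ) (r x : ℕ) : Set where
    constructor parsed
    field
      rest   : List Seg
      adm    : Adm (proj₂ v) rest x
      length : total (v ∷ rest) ≡ suc r
      follow : ∀ j → j ≤ r → f j ≡ trace (v ∷ rest) j

  parse-step : ∀ {f r x} v → f 0 ≡ v → v ↝ f 1 → Parsed (f 1) (f ∘ suc) r x → Parsed v f (suc r) x
  parse-step {f} (suc a , e) f0 h (parsed S adm len fol) = parsed S
    (subst (λ y → Adm (proj₂ y) S _) (sym h) adm)
    (cong suc (trans (cong (λ y → total (y ∷ S)) h) len))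
    λ { zero _ → f0 ; (suc j) (s≤s le) → trans (fol j le) (cong (λ y → trace (y ∷ S) j) (sym h)) }
  parse-step {f} (zero , y) f0 h (parsed S adm len fol) = parsed (f 1 ∷ S) (h , adm) (cong suc len)
    λ { zero _ → f0 ; (suc j) (s≤s le) → fol j le }

  parse : ∀ f r {x} → (∀ j → f j ↝ f (suc j)) → f r ≡ (0 , x) → Parsed (f 0) f r x
  parse f zero    st eq = parsed [] (cong proj₂ eq) (cong (λ y → total (y ∷ [])) eq) λ { .0 z≤n → refl }
  parse f (suc r) st eq = parse-step (f 0) refl (st 0) (parse (f ∘ suc) r (st ∘ suc) eq)

  -- Translation between vertex sequences and runs

  pcost : Vertex → ℕ
  pcost (pos e) = e
  pcost (zer p) = p

  toSegs : Vertex → List Step → ℕ → List Seg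
  toSegs u []        x = (pcost u , x) ∷ []
  toSegs u (D e ∷ L) x = (val u ∸ suc (suc e) , suc e) ∷ toSegs (pos e) L x
  toSegs u (N w ∷ L) x = (pcost u , val w) ∷ toSegs w L x

  ends-toSegs : ∀ u L x → ends (toSegs u L x) ≡ map sval L ∷ʳ x
  ends-toSegs u []        x = refl
  ends-toSegs u (D e ∷ L) x = cong (suc e ∷_) (ends-toSegs (pos e) L x)
  ends-toSegs u (N w ∷ L) x = cong (val w ∷_) (ends-toSegs w L x)

  total-toSegs : ∀ u L x → Good u L → total (toSegs u L x) ≡ weight 0 u L
  total-toSegs (pos e) [] x g = ℕₚ.+-identityʳ _
  total-toSegs (zer p) [] x g = ℕₚ.+-identityʳ _
  total-toSegs u (D e ∷ L) x (lt , g) = cong₂ _+_ (sym (ℕₚ.+-∸-assoc 1 lt)) (total-toSegs (pos e) L x g)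
  total-toSegs (pos e) (N w ∷ L) x g = cong (suc e +_) (total-toSegs w L x g)
  total-toSegs (zer p) (N w ∷ L) x g = cong (suc p +_) (total-toSegs w L x g)

  throw-pcost : ∀ u e → Throw (val u) (pcost u) e
  throw-pcost (pos e) _ = inj₂ (inj₁ refl)
  throw-pcost (zer p) _ = inj₁ refl

  adm-toSegs : ∀ u L x → Good u L → Adm (val u) (toSegs u L x) x
  adm-toSegs u []        x g        = throw-pcost u x , refl
  adm-toSegs u (D e ∷ L) x (lt , g) =
    inj₂ (inj₂ (sym (trans (sym (ℕₚ.+-suc _ (suc e))) (ℕₚ.m∸n+n≡m lt)))) , adm-toSegs (pos e) L x g
  adm-toSegs u (N w ∷ L) x g        = throw-pcost u (val w) , adm-toSegs w L x g

  fromSegs : ∀ {x y} w e S → Adm y ((w , e) ∷ S) x → y ≤ x → All (_≤ x) (ends ((w , e) ∷ S)) →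
             ∃₂ λ u L → val u ≡ y × Good u L × toSegs u L x ≡ (w , e) ∷ S
  fromSegs w e [] (inj₁ refl , refl) _ _ = zer w , [] , refl , tt , refl
  fromSegs w e [] (inj₂ (inj₁ refl) , refl) _ _ = pos w , [] , refl , tt , refl
  -- A discounted return to `x` would start above `x`, the largest vertex.
  fromSegs w e [] (inj₂ (inj₂ refl) , refl) le _ = ⊥-elim (ℕₚ.<⇒≱ (s≤s (ℕₚ.m≤n+m e w)) le)
  fromSegs w e ((w′ , e′) ∷ S) (th , adm) le (h ∷ all) with fromSegs w′ e′ S adm h all | th
  ... | u , L , refl , g , eq | inj₁ refl = zer w , N u ∷ L , refl , g , cong (_ ∷_) eq
  ... | u , L , refl , g , eq | inj₂ (inj₁ refl) = pos w , N u ∷ L , refl , g , cong (_ ∷_) eq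
  -- For an edge into 0 both kinds of throw coincide; it is always recorded as undiscounted, which
  -- keeps the coding unique.
  ... | zer p , L , refl , g , eq | inj₂ (inj₂ refl) =
    pos w , N (zer p) ∷ L , cong suc (sym (ℕₚ.+-identityʳ w)) , g , cong (_ ∷_) eq
  ... | pos e , L , refl , g , eq | inj₂ (inj₂ refl) =
    pos (w + suc e) , D e ∷ L , refl , (s≤s (ℕₚ.m≤n+m (suc e) w) , g) ,
    cong₂ (λ a → (a , suc e) ∷_) (ℕₚ.m+n∸n≡m w (suc e)) eq

  vertex-≡ : ∀ {u u′} → val u ≡ val u′ → pcost u ≡ pcost u′ → u ≡ u′
  vertex-≡ {pos _} {pos _} _ refl = refl
  vertex-≡ {zer _} {zer _} _ refl = refl

  vertex-≡⁺ : ∀ {u u′} → val u ≡ val u′ → 0 < val u → u ≡ u′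
  vertex-≡⁺ {pos _} {pos _} refl _ = refl

  toSegs-nonempty : ∀ u L x → toSegs u L x ≢ []
  toSegs-nonempty u []        x ()
  toSegs-nonempty u (D _ ∷ L) x ()
  toSegs-nonempty u (N _ ∷ L) x ()

  -- A discount is at least one unit, so durations tell apart the two kinds of edge out of one
  -- vertex.
  pcost≢ : ∀ {u u′ e} → suc e < val u′ → val u ≡ val u′ → pcost u ≢ val u′ ∸ suc (suc e)
  pcost≢ {pos a} {pos _} (s≤s lt) refl eq = ℕₚ.<⇒≢ (ℕₚ.∸-monoʳ-< (s≤s z≤n) lt) (sym eq)

  toSegs-injective : ∀ {u u′} L L′ x → val u ≡ val u′ → Good u L → Good u′ L′ →
                     toSegs u L x ≡ toSegs u′ L′ x → u ≡ u′ × L ≡ L′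
  toSegs-injective [] [] x v _ _ eq = vertex-≡ v (,-injectiveˡ (∷-injectiveˡ eq)) , refl
  toSegs-injective [] (D _ ∷ L′) x _ _ _ eq = ⊥-elim (toSegs-nonempty _ L′ x (sym (∷-injectiveʳ eq)))
  toSegs-injective [] (N _ ∷ L′) x _ _ _ eq = ⊥-elim (toSegs-nonempty _ L′ x (sym (∷-injectiveʳ eq)))
  toSegs-injective (D _ ∷ L) [] x _ _ _ eq = ⊥-elim (toSegs-nonempty _ L x (∷-injectiveʳ eq))
  toSegs-injective (N _ ∷ L) [] x _ _ _ eq = ⊥-elim (toSegs-nonempty _ L x (∷-injectiveʳ eq))
  toSegs-injective (D e ∷ L) (D e′ ∷ L′) x v (lt , g) (_ , g′) eq
    with heq , teq ← ∷-injective eq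
    with refl ← ,-injectiveʳ heq
    with _ , refl ← toSegs-injective L L′ x refl g g′ teq = vertex-≡⁺ v (ℕₚ.<-trans (s≤s z≤n) lt) , refl
  toSegs-injective (N w ∷ L) (N w′ ∷ L′) x v g g′ eq
    with heq , teq ← ∷-injective eq
    with refl , refl ← toSegs-injective L L′ x (,-injectiveʳ heq) g g′ teq = vertex-≡ v (,-injectiveˡ heq) , refl
  toSegs-injective {u} {u′} (N w ∷ L) (D e ∷ L′) x v g (lt , _) eq =
    ⊥-elim (pcost≢ {u} {u′} lt v (,-injectiveˡ (∷-injectiveˡ eq)))
  toSegs-injective {u} {u′} (D e ∷ L) (N w ∷ L′) x v (lt , _) g eq =
    ⊥-elim (pcost≢ {u′} {u} lt (sym v) (sym (,-injectiveˡ (∷-injectiveˡ eq))))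

  -- A cycle of length n cut after its largest vertex.
  record Closed (n : ℕ) (S : List Seg) : Set where
    constructor closed
    field
      {top}   : ℕ
      adm     : Adm top S top
      unique  : Unique (ends S)
      maximal : All (_≤ top) (ends S)
      length  : total S ≡ n

  encode : Path → List Seg
  encode (u , L) = toSegs u L (val u)

  full-closed : ∀ {n} z → Full n z → Closed n (encode z)
  full-closed (u , L) (mkStruct _ g uq r , eq) = closed
    (adm-toSegs u L (val u) g)
    (subst Unique (sym e) (unique-resp-↭ p (Allₚ.map⁺ (All.map (λ h → ℕₚ.<⇒≢ (proj₂ h) ∘ sym) r) ∷ uq)))
    (subst (All (_≤ val u)) (sym e) (All-resp-↭ p (ℕₚ.≤-refl ∷ Allₚ.map⁺ (All.map (ℕₚ.<⇒≤ ∘ proj₂) r))))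
    (trans (total-toSegs u L (val u) g) eq)
    where
    e = ends-toSegs u L (val u)
    p = ∷↭∷ʳ (val u) (map sval L)

  closed-full : ∀ {n S} → Closed (suc n) S → ∃ λ z → Full (suc n) z × encode z ≡ S
  closed-full {S = (w , e) ∷ S} (closed {x} adm uq mx len)
    with u , L , refl , g , te ← fromSegs w e S adm ℕₚ.≤-refl mx
    with eq ← trans (sym (cong ends te)) (ends-toSegs u L (val u))
    with n ∷ uq′ ← unique-resp-↭ (↭-sym (∷↭∷ʳ (val u) (map sval L))) (subst Unique eq uq)
       | _ ∷ mx′ ← All-resp-↭ (↭-sym (∷↭∷ʳ (val u) (map sval L))) (subst (All (_≤ val u)) eq mx)
    = (u , L) , (mkStruct z≤n g uq′ (All.map (λ { (ne , le) → z≤n , ℕₚ.≤∧≢⇒< le (ne ∘ sym) })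
                                             (All.zip (Allₚ.map⁻ n , Allₚ.map⁻ mx′))) ,
                 trans (sym (total-toSegs u L (val u) g)) (trans (cong total te) len)) , te

  adm-end : ∀ {y x x′} S → Adm y S x → Adm y S x′ → x ≡ x′
  adm-end []      refl    refl     = refl
  adm-end (_ ∷ S) (_ , a) (_ , a′) = adm-end S a a′

  adm-end⁺ : ∀ {y y′ x x′ S S′} → S ≢ [] → S ≡ S′ → Adm y S x → Adm y′ S′ x′ → x ≡ x′
  adm-end⁺ {S = []}    ne refl _       _        = ⊥-elim (ne refl)
  adm-end⁺ {S = _ ∷ S} ne refl (_ , a) (_ , a′) = adm-end S a a′

  encode-injective : ∀ {n z z′} → Full n z → Full n z′ → encode z ≡ encode z′ → z ≡ z′
  encode-injective {z = u , L} {u′ , L′} (mkStruct _ g _ _ , _) (mkStruct _ g′ _ _ , _) eq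
    with v ← adm-end⁺ (toSegs-nonempty u L (val u)) eq (adm-toSegs u L (val u) g) (adm-toSegs u′ L′ (val u′) g′)
    with refl , refl ← toSegs-injective L L′ (val u) v g g′ (trans eq (cong (toSegs u′ L′) (sym v))) = refl

  -- Closed lists of runs as cycles up to rotation

  module _ {n : ℕ} where

    private
      m : ℕ
      m = suc n

    %-suc : ∀ i → (suc (i % m) < m × suc i % m ≡ suc (i % m)) ⊎ (suc (i % m) ≡ m × suc i % m ≡ 0)
    %-suc i with ℕₚ.m≤n⇒m<n∨m≡n (m%n<n i m)
               | trans (cong (λ k → suc k % m) (m≡m%n+[m/n]*n i m)) ([m+kn]%n≡m%n (suc (i % m)) (i / m) m)
    ... | inj₁ lt | eq = inj₁ (lt , trans eq (m<n⇒m%n≡m lt))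
    ... | inj₂ e  | eq = inj₂ (e , trans eq (trans (cong (_% m) e) (n%n≡0 m)))

    orbit : List Seg → ℕ → ℕ × ℕ
    orbit S i = trace S (i % m)

    orbit-step : ∀ {S} → Closed m S → ∀ i → orbit S i ↝ orbit S (suc i)
    orbit-step {(w , e) ∷ S} (closed (th , adm) uq mx len) i with %-suc i
    ... | inj₁ (lt , eq) rewrite eq = trace-step w e S (i % m) adm (subst (suc (i % m) <_) (sym len) lt)
    ... | inj₂ (e₁ , eq) rewrite eq | trace-last w e S (i % m) adm (trans e₁ (sym len)) = th

    toCycle : ∀ {S} → Closed m S → Cycle m
    toCycle {S} c = record
      { st       = mk ∘ orbit S
      ; periodic = λ i → cong (mk ∘ trace S) ([m+n]%n≡m%n i m)
      ; step     = λ i → ↝⇒⇒ _ _ (orbit-step c i)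
      ; distinct = λ i j i< j< eq → trans (sym (m<n⇒m%n≡m i<)) (trans
          (trace-injective S (i % m) (j % m) (Closed.unique c) (bound i) (bound j) (mk-injective eq))
          (m<n⇒m%n≡m j<)) }
      where
      bound : ∀ i → i % m < total S
      bound i = subst (i % m <_) (sym (Closed.length c)) (m%n<n i m)

    periodic-* : ∀ (c : Cycle m) i k → st c (i + k * m) ≡ st c i
    periodic-* c i zero    = cong (st c) (ℕₚ.+-identityʳ i)
    periodic-* c i (suc k) = trans (cong (st c) (lemma i m (k * m))) (trans (periodic c (i + k * m)) (periodic-* c i k))
      where
      lemma : ∀ i m x → i + (m + x) ≡ i + x + m
      lemma = solve-∀

    rot-sym : ∀ {c d : Cycle m} → Rot c d → Rot d c
    -- `n * k` completes `k` to a multiple of the period `n + 1`.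
    rot-sym {c} {d} (k , h) = n * k , λ i → sym (trans (h (i + n * k)) (trans (cong (st c) (lemma i n k)) (periodic-* c i k)))
      where
      lemma : ∀ i n k → i + n * k + k ≡ i + k * (1 + n)
      lemma = solve-∀

    rot-trans : ∀ {c d e : Cycle m} → Rot c d → Rot d e → Rot c e
    rot-trans {c} (k , h) (l , h′) = l + k , λ i → trans (h′ i) (trans (h (i + l)) (cong (st c) (ℕₚ.+-assoc i l k)))

    rot-resp : ∀ {S S′ c} (cl : Closed m S) (cl′ : Closed m S′) → S ≡ S′ → Rot (toCycle cl) c → Rot (toCycle cl′) c
    rot-resp _ _ refl r = r

    last-orbit : ∀ {S} (c : Closed m S) → orbit S n ≡ (0 , Closed.top c)
    last-orbit {(w , e) ∷ S} (closed (_ , adm) _ _ len) =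
      trans (cong (trace ((w , e) ∷ S)) (m<n⇒m%n≡m {n = m} {m = n} ℕₚ.≤-refl)) (trace-last w e S n adm (sym len))

    orbit-bound : ∀ {S} (c : Closed m S) i → proj₂ (orbit S i) ≤ Closed.top c
    orbit-bound {S} c i = All.lookup (Closed.maximal c)
      (trace-ends S (i % m) (subst (i % m <_) (sym (Closed.length c)) (m%n<n i m)))

    rot-top : ∀ {S S′} (c : Closed m S) (c′ : Closed m S′) → Rot (toCycle c) (toCycle c′) → Closed.top c′ ≤ Closed.top c
    rot-top c c′ (k , h) = subst (_≤ Closed.top c)
      (cong proj₂ (trans (sym (mk-injective (h n))) (last-orbit c′))) (orbit-bound c (n + k))

    rot-segments : ∀ {S S′} (c : Closed m S) (c′ : Closed m S′) → Rot (toCycle c) (toCycle c′) → S ≡ S′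
    rot-segments {S} {S′} c c′ r@(k , h) = begin
      S                            ≡⟨ segments-trace S ⟨
      segments (trace S) (total S) ≡⟨ cong (segments (trace S)) (Closed.length c) ⟩
      segments (trace S) m         ≡⟨ segments-cong m same ⟩
      segments (trace S′) m        ≡⟨ cong (segments (trace S′)) (Closed.length c′) ⟨
      segments (trace S′) (total S′) ≡⟨ segments-trace S′ ⟩
      S′                           ∎
      where
      open ≡-Reasoning
      top-≡ : Closed.top c ≡ Closed.top c′
      top-≡ = ℕₚ.≤-antisym (rot-top c′ c (rot-sym {toCycle c} {toCycle c′} r)) (rot-top c c′ r)
      bound : ∀ i → i % m < total S
      bound i = subst (i % m <_) (sym (Closed.length c)) (m%n<n i m)
      -- The maximal vertex occurs only once, so k is a multiple of the period.
      k-mod : (n + k) % m ≡ n % m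
      k-mod = trace-injective S _ _ (Closed.unique c) (bound (n + k)) (bound n)
        (trans (sym (mk-injective (h n))) (trans (last-orbit c′) (trans (cong (0 ,_) (sym top-≡)) (sym (last-orbit c)))))
      shift-mod : ∀ i → (i + k) % m ≡ i % m
      shift-mod i = begin
        (i + k) % m               ≡⟨ [m+n]%n≡m%n (i + k) m ⟨
        (i + k + m) % m           ≡⟨ cong (_% m) (lemma i k n) ⟩
        (suc i + (n + k)) % m     ≡⟨ %-distribˡ-+ (suc i) (n + k) m ⟩
        (suc i % m + (n + k) % m) % m ≡⟨ cong (λ x → (suc i % m + x) % m) k-mod ⟩
        (suc i % m + n % m) % m   ≡⟨ %-distribˡ-+ (suc i) n m ⟨
        (suc i + n) % m           ≡⟨ cong (_% m) (sym (ℕₚ.+-suc i n)) ⟩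
        (i + m) % m               ≡⟨ [m+n]%n≡m%n i m ⟩
        i % m                     ∎
        where
        lemma : ∀ i k n → i + k + (1 + n) ≡ 1 + i + (n + k)
        lemma = solve-∀
      same : ∀ j → j < m → trace S j ≡ trace S′ j
      same j lt = begin
        trace S j             ≡⟨ cong (trace S) (m<n⇒m%n≡m lt) ⟨
        trace S (j % m)       ≡⟨ cong (trace S) (shift-mod j) ⟨
        orbit S (j + k)       ≡⟨ mk-injective (h j) ⟨
        orbit S′ j            ≡⟨ cong (trace S′) (m<n⇒m%n≡m lt) ⟩
        trace S′ j            ∎

  -- Cutting a given cycle after its largest vertex

  argmax : ∀ (g : ℕ → ℕ) r → ∃ λ j → ∀ i → i < suc r → g i ≤ g j
  argmax g zero    = 0 , λ { .0 (s≤s z≤n) → ℕₚ.≤-refl }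
  argmax g (suc r) with argmax g r
  ... | j , h with ℕₚ.≤-total (g j) (g (suc r))
  ... | inj₁ le = suc r , λ i lt → [ (λ lt′ → ℕₚ.≤-trans (h i lt′) le) , (λ { refl → ℕₚ.≤-refl }) ]
      (ℕₚ.m≤n⇒m<n∨m≡n (ℕₚ.≤-pred lt))
  ... | inj₂ le = j , λ i lt → [ h i , (λ { refl → le }) ] (ℕₚ.m≤n⇒m<n∨m≡n (ℕₚ.≤-pred lt))

  -- Waiting is forced, so a state with the largest second coordinate leads to the largest vertex.
  descend : ∀ (f : ℕ → ℕ × ℕ) → (∀ i → f i ↝ f (suc i)) → ∀ a i {x} → f i ≡ (a , x) → f (i + a) ≡ (0 , x)
  descend f st zero    i eq = trans (cong f (ℕₚ.+-identityʳ i)) eq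
  descend f st (suc a) i eq = trans (cong f (ℕₚ.+-suc i a))
    (descend f st a (suc i) (sym (subst (_↝ f (suc i)) eq (st i))))

  module _ {n : ℕ} (c : Cycle (suc n)) where

    private
      m : ℕ
      m = suc n
      f : ℕ → ℕ × ℕ
      f = coords ∘ st c
      f-step : ∀ i → f i ↝ f (suc i)
      f-step i = ⇒⇒↝ {st c i} {st c (suc i)} (step c i)
      st-% : ∀ i → st c (i % m) ≡ st c i
      st-% i = trans (sym (periodic-* c (i % m) (i / m))) (cong (st c) (sym (m≡m%n+[m/n]*n i m)))
      j₀ : ℕ
      j₀ = proj₁ (argmax (proj₂ ∘ f) n)
      x : ℕ
      x = proj₂ (f j₀)
      x-max : ∀ i → proj₂ (f i) ≤ x
      x-max i = subst (_≤ x) (cong (proj₂ ∘ coords) (st-% i)) (proj₂ (argmax (proj₂ ∘ f) n) (i % m) (m%n<n i m))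
      k : ℕ
      k = j₀ + proj₁ (f j₀)
      f-k : f k ≡ (0 , x)
      f-k = descend f f-step (proj₁ (f j₀)) j₀ refl
      -- Starting one step after the largest vertex `f k` makes it the last state, at time `n`, of
      -- the period.
      g : ℕ → ℕ × ℕ
      g j = f (j + suc k)
      g-n : g n ≡ (0 , x)
      g-n = trans (cong coords (trans (cong (st c) (lemma n k)) (periodic c k))) f-k
        where
        lemma : ∀ n k → n + (1 + k) ≡ k + (1 + n)
        lemma = solve-∀
      parsed-g : Parsed (g 0) g n x
      parsed-g = parse g n (λ j → f-step (j + suc k)) g-n
      segs : List Seg
      segs = g 0 ∷ Parsed.rest parsed-g
      follow : ∀ j → j < m → g j ≡ trace segs j
      follow j lt = Parsed.follow parsed-g j (ℕₚ.≤-pred lt)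
      len : total segs ≡ m
      len = Parsed.length parsed-g
      coords-injective : ∀ {s s′} → coords s ≡ coords s′ → s ≡ s′
      coords-injective eq = trans (sym (mk-coords _)) (trans (cong mk eq) (mk-coords _))

    +-mod-cancel : ∀ i j l → (i + l) % m ≡ (j + l) % m → i % m ≡ j % m
    +-mod-cancel i j l eq = trans (sym (lem i)) (trans step₂ (lem j))
      where
      lem : ∀ i → (i + l + n * l) % m ≡ i % m
      lem i = trans (cong (_% m) (ring i l n)) ([m+kn]%n≡m%n i l m)
        where
        ring : ∀ i l n → i + l + n * l ≡ i + l * (1 + n)
        ring = solve-∀
      step₂ : (i + l + n * l) % m ≡ (j + l + n * l) % m
      step₂ = trans (%-distribˡ-+ (i + l) (n * l) m)
        (trans (cong (λ x → (x + n * l % m) % m) eq) (sym (%-distribˡ-+ (j + l) (n * l) m)))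

    cycle-closed : Closed m segs
    cycle-closed = closed
      (subst (λ y → Throw y (proj₁ (g 0)) (proj₂ (g 0))) (cong proj₂ f-k)
         (throw (f k) (cong proj₁ f-k) (f-step k)) , Parsed.adm parsed-g)
      (ends-unique segs (λ i j i< j< eq →
        let i<m = subst (i <_) len i< ; j<m = subst (j <_) len j< in
        trans (sym (m<n⇒m%n≡m i<m)) (trans
          (+-mod-cancel i j (suc k) (distinct c ((i + suc k) % m) ((j + suc k) % m) (m%n<n (i + suc k) m) (m%n<n (j + suc k) m)
            (trans (st-% (i + suc k)) (trans (coords-injective (trans (follow i i<m) (trans eq (sym (follow j j<m)))))
                   (sym (st-% (j + suc k)))))))
          (m<n⇒m%n≡m j<m))))
      (All.tabulate (λ e∈ → let (j , lt , eq) = ends-trace segs e∈ in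
        subst (_≤ x) (cong proj₂ (trans (follow j (subst (j <_) len lt)) eq)) (x-max (j + suc k))))
      len
      where
      throw : ∀ v {y} → proj₁ v ≡ 0 → v ↝ y → Throw (proj₂ v) (proj₁ y) (proj₂ y)
      throw (zero , _) _ h = h

    cycle-rot : Rot (toCycle cycle-closed) c
    cycle-rot = rot-sym {c = c} {toCycle cycle-closed} (suc k , λ i → coords-injective (begin
      coords (mk (trace segs (i % m))) ≡⟨ coords-mk _ ⟩
      trace segs (i % m)               ≡⟨ follow (i % m) (m%n<n i m) ⟨
      f (i % m + suc k)                ≡⟨ cong coords (st-% (i % m + suc k)) ⟨
      f ((i % m + suc k) % m)          ≡⟨ cong f (trans (%-distribˡ-+ (i % m) (suc k) m)
                                            (trans (cong (λ x → (x + suc k % m) % m) (m%n%n≡m%n i m))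
                                                   (sym (%-distribˡ-+ i (suc k) m)))) ⟩
      f ((i + suc k) % m)              ≡⟨ cong coords (st-% (i + suc k)) ⟩
      f (i + suc k)                    ∎))
      where open ≡-Reasoning

    cycle-segments : ∃ λ S → Σ (Closed m S) λ cl → Rot (toCycle cl) c
    cycle-segments = segs , cycle-closed , cycle-rot

  counts-cycles : ∀ {n k} → Counts (Full (suc n)) k → CountUpToRot (suc n) k
  counts-cycles {n} {k} counts = cycle , surjective , injective
    where
    open Counts counts
    cl : ∀ i → Closed (suc n) (encode (enum i))
    cl i = full-closed (enum i) (sound i)
    cycle : Fin k → Cycle (suc n)
    cycle i = toCycle (cl i)
    surjective : ∀ c → ∃ λ i → Rot (cycle i) c
    surjective c = let (_ , clo , r) = cycle-segments c ; (_ , full , eq) = closed-full clo ; (i , eq′) = complete full in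
      i , rot-resp {c = c} clo (cl i) (sym (trans (cong encode eq′) eq)) r
    injective : ∀ i j → Rot (cycle i) (cycle j) → i ≡ j
    injective i j r = inj (encode-injective (sound i) (sound j) (rot-segments (cl i) (cl j) r))

  -- Sending each representative of one family to its representative in the other is injective, so
  -- the pigeonhole principle applies in both directions.
  count-unique : ∀ {n k l} → CountUpToRot (suc n) k → CountUpToRot (suc n) l → k ≡ l
  count-unique c c′ = ℕₚ.≤-antisym (half c c′) (half c′ c)
    where
    half : ∀ {n k l} → CountUpToRot (suc n) k → CountUpToRot (suc n) l → k ≤ l
    half {n} (f , _ , f-inj) (g , g-surj , _) = Finₚ.injective⇒≤ {f = λ i → proj₁ (g-surj (f i))} λ {i} {j} eq →
      f-inj i j (rot-trans {c = f i} {g _} {f j} (rot-sym {c = g _} {f i} (proj₂ (g-surj (f i))))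
        (subst (λ a → Rot (g a) (f j)) (sym eq) (proj₂ (g-surj (f j)))))

  full-count : ∀ n → CountUpToRot (suc n) (fullCount (suc n))
  full-count n = counts-cycles (counts-full (suc n) (s≤s z≤n))

  -- The recurrence for the numbers of cycles

  shift-+ : ∀ t f n → shift t f (t + n) ≡ f n
  shift-+ zero    f n = refl
  shift-+ (suc t) f n = shift-+ t f n

  shift-< : ∀ t f n → n < t → shift t f n ≡ 0
  shift-< (suc t) f zero    _        = refl
  shift-< (suc t) f (suc n) (s≤s lt) = shift-< t f n lt

  shift-cong : ∀ t {f g : ℕ → ℕ} n → (∀ m → n ≡ t + m → f m ≡ g m) → shift t f n ≡ shift t g n
  shift-cong zero    n       h = h n refl
  shift-cong (suc t) zero    h = refl
  shift-cong (suc t) (suc n) h = shift-cong t n (λ m eq → h m (cong suc eq))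

  B-zero : ∀ H t → B H t 0 ≡ 0
  B-zero zero    t             = refl
  B-zero (suc H) zero          = refl
  B-zero (suc H) (suc zero)    = refl
  B-zero (suc H) (suc (suc t)) = refl

  B-stable : ∀ H H′ t n → n ≤ H → n ≤ H′ → B H t n ≡ B H′ t n
  B-stable zero    H′       t       .0 z≤n _   = sym (B-zero H′ t)
  B-stable (suc H) zero     t       .0 _   z≤n = B-zero (suc H) t
  B-stable (suc H) (suc H′) zero    n  _   _   = refl
  B-stable (suc H) (suc H′) (suc t) n  p   p′  = cong (base t n +_) (shift-cong (suc t) n λ { m refl →
    let q = ℕₚ.≤-trans (ℕₚ.m≤n+m m t) (ℕₚ.≤-pred p) ; q′ = ℕₚ.≤-trans (ℕₚ.m≤n+m m t) (ℕₚ.≤-pred p′) in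
    cong₂ (λ x y → suc (suc t) * x + t * y) (B-stable H H′ (suc t) m q q′) (B-stable H H′ t m q q′) })

  b : ℕ → ℕ → ℕ
  b t n = B n t n

  b-step : ∀ t n → b (suc t) (suc t + n) ≡ base t (suc t + n) + (suc (suc t) * b (suc t) n + t * b t n)
  b-step t n = cong (base t (suc t + n) +_) (trans (shift-+ t _ n)
    (cong₂ (λ x y → suc (suc t) * x + t * y)
      (B-stable (t + n) n (suc t) n (ℕₚ.m≤n+m n t) ℕₚ.≤-refl) (B-stable (t + n) n t n (ℕₚ.m≤n+m n t) ℕₚ.≤-refl)))

  -- A single chain is its top `n + 1` together with any subset of the `n` positive vertices below
  -- it.
  b-1 : ∀ n → b 1 (suc n) ≡ 2 ^ n
  b-1 zero    = refl
  b-1 (suc n) = trans (b-step 0 (suc n)) (trans (ℕₚ.+-identityʳ (2 * b 1 (suc n))) (cong (2 *_) (b-1 n)))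

  b-rec : ∀ k n → b (2 + k) (2 + k + n) ≡ (3 + k) * b (2 + k) n + (1 + k) * b (1 + k) n
  b-rec k n = b-step (suc k) n

  b-small : ∀ k n → n < 2 + k → b (2 + k) n ≡ 0
  b-small k zero    _  = refl
  b-small k (suc n) lt = shift-< (2 + k) _ (suc n) lt

  sum<-cong : ∀ k {f g : ℕ → ℕ} → (∀ t → t < k → f t ≡ g t) → sum< k f ≡ sum< k g
  sum<-cong zero    h = refl
  sum<-cong (suc k) h = cong₂ _+_ (sum<-cong k (λ t t<k → h t (ℕₚ.m<n⇒m<1+n t<k))) (h k ℕₚ.≤-refl)

  sum<-* : ∀ k c f → sum< k (λ t → c * f t) ≡ c * sum< k f
  sum<-* zero    c f = sym (ℕₚ.*-zeroʳ c)
  sum<-* (suc k) c f = trans (cong (_+ c * f k) (sum<-* k c f)) (sym (ℕₚ.*-distribˡ-+ c (sum< k f) (f k)))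

  fullCount-b : ∀ n → fullCount n ≡
    1 + (sum< n (λ t → b (suc t) n) + sum< n (λ t → suc t * sum< n (b (suc t))))
  fullCount-b n = cong (λ x → 1 + (sum< n (λ t → b (suc t) n) + x)) (sum<-cong n λ t _ →
    trans (sum<-* n (suc t) (B n (suc t)))
          (cong (suc t *_) (sum<-cong n λ m m<n → B-stable n m (suc t) m (ℕₚ.<⇒≤ m<n) ℕₚ.≤-refl)))

  -- Estimates for powers of two

  1+k≤2^k : ∀ k → 1 + k ≤ 2 ^ k
  1+k≤2^k zero    = ℕₚ.≤-refl
  1+k≤2^k (suc k) = ℕₚ.≤-trans (ℕₚ.≤-reflexive (ℕₚ.+-comm 1 (suc k)))
    (ℕₚ.+-mono-≤ (1+k≤2^k k) (ℕₚ.≤-trans (ℕₚ.≤-trans (s≤s z≤n) (1+k≤2^k k)) (ℕₚ.m≤m+n _ 0)))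

  -- For `t = 2 + k`, this and `scale₃` say (t - 1)/2^t ≤ 1/4 and (t + 1)/2^t ≤ 3/4. Both are sharp
  -- at t = 2, and the two bounds add up to one.
  scale₁ : ∀ k → (1 + k) * 4 ≤ 1 * 2 ^ (2 + k)
  scale₁ k = ℕₚ.≤-trans (ℕₚ.*-monoˡ-≤ 4 (1+k≤2^k k)) (ℕₚ.≤-reflexive (lemma (2 ^ k)))
    where
    lemma : ∀ x → x * 4 ≡ 1 * (2 * (2 * x))
    lemma = solve-∀

  scale₃ : ∀ k → (3 + k) * 4 ≤ 3 * 2 ^ (2 + k)
  scale₃ k = ℕₚ.≤-trans (ℕₚ.*-monoˡ-≤ 4 (ℕₚ.≤-trans (ℕₚ.m≤m+n (3 + k) (2 * k))
    (ℕₚ.≤-trans (ℕₚ.≤-reflexive (lemma₁ k)) (ℕₚ.*-monoʳ-≤ 3 (1+k≤2^k k)))))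
    (ℕₚ.≤-reflexive (lemma (2 ^ k)))
    where
    lemma₁ : ∀ k → 3 + k + 2 * k ≡ 3 * (1 + k)
    lemma₁ = solve-∀
    lemma : ∀ x → 3 * x * 4 ≡ 3 * (2 * (2 * x))
    lemma = solve-∀

  13+3j≤2^ : ∀ j → 13 + 3 * j ≤ 2 ^ (4 + j)
  13+3j≤2^ zero    = ℕₚ.m≤m+n 13 3
  13+3j≤2^ (suc j) = ℕₚ.≤-trans (ℕₚ.m≤m+n _ (10 + 3 * j)) (ℕₚ.≤-trans (ℕₚ.≤-reflexive (lemma j)) (ℕₚ.*-monoʳ-≤ 2 (13+3j≤2^ j)))
    where
    lemma : ∀ j → 13 + 3 * (1 + j) + (10 + 3 * j) ≡ 2 * (13 + 3 * j)
    lemma = solve-∀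

  den : ℕ → ℕ
  den k = 2 ^ (k + 2) ∸ (k + 3)

  den-+ : ∀ k → den k + (3 + k) ≡ 2 ^ (2 + k)
  den-+ k = trans (cong (den k +_) (ℕₚ.+-comm 3 k)) (trans (ℕₚ.m∸n+n≡m le) (cong (2 ^_) (ℕₚ.+-comm k 2)))
    where
    lemma : ∀ k → 3 + k + (1 + 3 * k) ≡ (1 + k) * 4
    lemma = solve-∀
    le : k + 3 ≤ 2 ^ (k + 2)
    le = subst₂ _≤_ (ℕₚ.+-comm 3 k) (cong (2 ^_) (ℕₚ.+-comm 2 k))
      (ℕₚ.≤-trans (ℕₚ.m≤m+n (3 + k) (1 + 3 * k)) (ℕₚ.≤-trans (ℕₚ.≤-reflexive (lemma k))
        (ℕₚ.≤-trans (scale₁ k) (ℕₚ.≤-reflexive (ℕₚ.*-identityˡ _)))))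

  -- The halving of the terms of γ with denominators cleared. Moving the subtracted part of `den` to
  -- the left gives a polynomial 2 short of (4 + j)(13 + 3j), the origin of the linear bound on 2^(4
  -- + j).
  den-bound : ∀ j → 2 * (5 + j) * (3 + j) ≤ (4 + j) * den (2 + j)
  den-bound j = ℕₚ.+-cancelʳ-≤ ((4 + j) * (5 + j)) _ _ (begin
    2 * (5 + j) * (3 + j) + (4 + j) * (5 + j)      ≤⟨ ℕₚ.m≤m+n _ 2 ⟩
    2 * (5 + j) * (3 + j) + (4 + j) * (5 + j) + 2  ≡⟨ lemma j ⟩
    (4 + j) * (13 + 3 * j)                         ≤⟨ ℕₚ.*-monoʳ-≤ (4 + j) (13+3j≤2^ j) ⟩
    (4 + j) * 2 ^ (4 + j)                          ≡⟨ cong ((4 + j) *_) (den-+ (2 + j)) ⟨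
    (4 + j) * (den (2 + j) + (5 + j))              ≡⟨ ℕₚ.*-distribˡ-+ (4 + j) (den (2 + j)) (5 + j) ⟩
    (4 + j) * den (2 + j) + (4 + j) * (5 + j)      ∎)
    where
    open ℕₚ.≤-Reasoning
    lemma : ∀ j → 2 * (5 + j) * (3 + j) + (4 + j) * (5 + j) + 2 ≡ (4 + j) * (13 + 3 * j)
    lemma = solve-∀

  step-induction : ∀ {P : ℕ → Set} s → (∀ n → n < suc s → P n) → (∀ n → P n → P (suc s + n)) → ∀ n → P n
  step-induction {P} s small step = <-rec P go
    where
    go : ∀ n → (∀ {m} → m < n → P m) → P n
    go n ih with n <? suc s
    ... | yes lt = small n lt
    ... | no ge  = subst P (ℕₚ.m+[n∸m]≡n (ℕₚ.≮⇒≥ ge)) (step (n ∸ suc s) (ih (n∸s<n n (ℕₚ.≮⇒≥ ge))))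
      where
      n∸s<n : ∀ n → suc s ≤ n → n ∸ suc s < n
      n∸s<n (suc n) _ = s≤s (ℕₚ.m∸n≤m n s)

module Limits where

  open Cycles using (sum<; fullCount; b; b-1; b-rec; b-small; fullCount-b; scale₁; scale₃; den; den-+; den-bound; step-induction)
  open import Data.Integer using (+_)
  import Data.Integer as ℤ
  import Data.Integer.Properties as ℤₚ
  open import Data.Nat as ℕ using (ℕ; zero; suc; z≤n; s≤s; NonZero; _^_)
  import Data.Nat.Properties as ℕₚ
  open import Data.Nat.Tactic.RingSolver using (solve-∀)
  open import Data.Rational hiding (NonZero; _≥_)
  import Data.Rational.Properties as ℚₚ
  open import Data.Rational.Solver using (module +-*-Solver)
  open +-*-Solver using (solve; _:+_; _:*_; _:-_; :-_; con; _:=_)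
  open import Data.Rational.Unnormalised as ℚᵘ using (mkℚᵘ; *≡*)
  import Data.Rational.Unnormalised.Properties as ℚᵘₚ
  open import Data.Sum using (inj₁; inj₂)

  -- Vanishing sequences of rationals

  opaque
    ι : ℕ → ℚ
    ι n = + n / 1

    ι-def : ∀ n → ι n ≡ + n / 1
    ι-def n = refl

    ι-0 : ι 0 ≡ 0ℚ
    ι-0 = refl

    ι-1 : ι 1 ≡ 1ℚ
    ι-1 = refl

  ¼ ¾ 3ℚ : ℚ
  ¼  = + 1 / 4
  ¾  = + 3 / 4
  3ℚ = + 3 / 1

  0≤¼ : 0ℚ ≤ ¼
  0≤¼ = ℚₚ.nonNegative⁻¹ ¼

  fromℚᵘ-homo-* : ∀ p r → fromℚᵘ p * fromℚᵘ r ≡ fromℚᵘ (p ℚᵘ.* r)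
  fromℚᵘ-homo-* p r = ℚₚ.toℚᵘ-injective (ℚᵘₚ.≃-trans (ℚₚ.toℚᵘ-homo-* (fromℚᵘ p) (fromℚᵘ r))
    (ℚᵘₚ.≃-trans (ℚᵘₚ.*-cong (ℚₚ.toℚᵘ-fromℚᵘ p) (ℚₚ.toℚᵘ-fromℚᵘ r)) (ℚᵘₚ.≃-sym (ℚₚ.toℚᵘ-fromℚᵘ _))))

  fromℚᵘ-homo-+ : ∀ p r → fromℚᵘ p + fromℚᵘ r ≡ fromℚᵘ (p ℚᵘ.+ r)
  fromℚᵘ-homo-+ p r = ℚₚ.toℚᵘ-injective (ℚᵘₚ.≃-trans (ℚₚ.toℚᵘ-homo-+ (fromℚᵘ p) (fromℚᵘ r))
    (ℚᵘₚ.≃-trans (ℚᵘₚ.+-cong (ℚₚ.toℚᵘ-fromℚᵘ p) (ℚₚ.toℚᵘ-fromℚᵘ r)) (ℚᵘₚ.≃-sym (ℚₚ.toℚᵘ-fromℚᵘ _))))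

  opaque
    unfolding ι

    ι-* : ∀ m n → ι (m ℕ.* n) ≡ ι m * ι n
    ι-* m n = sym (trans (fromℚᵘ-homo-* (mkℚᵘ (+ m) 0) (mkℚᵘ (+ n) 0)) (cong (_/ 1) (sym (ℤₚ.pos-* m n))))

    ι-+ : ∀ m n → ι (m ℕ.+ n) ≡ ι m + ι n
    ι-+ m n = sym (trans (fromℚᵘ-homo-+ (mkℚᵘ (+ m) 0) (mkℚᵘ (+ n) 0))
      (cong (_/ 1) (cong₂ ℤ._+_ (ℤₚ.*-identityʳ (+ m)) (ℤₚ.*-identityʳ (+ n)))))

    ι-/ : ∀ m d .{{_ : NonZero d}} → ι d * (+ m / d) ≡ ι m
    ι-/ m (suc d) = trans (fromℚᵘ-homo-* (mkℚᵘ (+ suc d) 0) (mkℚᵘ (+ m) d))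
      (ℚₚ.fromℚᵘ-cong {mkℚᵘ (+ suc d) 0 ℚᵘ.* mkℚᵘ (+ m) d} {mkℚᵘ (+ m) 0} (*≡* (trans (ℤₚ.*-identityʳ (+ suc d ℤ.* + m))
        (trans (ℤₚ.*-comm (+ suc d) (+ m)) (cong (λ k → + m ℤ.* + suc k) (sym (ℕₚ.+-identityʳ d)))))))

    0≤ι : ∀ n → 0ℚ ≤ ι n
    0≤ι n = ℚₚ.nonNegative⁻¹ (ι n) {{ℚₚ.normalize-nonNeg n 1}}

  ι-suc : ∀ n → ι (suc n) ≡ 1ℚ + ι n
  ι-suc n = trans (ι-+ 1 n) (cong (_+ ι n) ι-1)

  ≤-by : ∀ {p r} d → 0ℚ ≤ d → p + d ≡ r → p ≤ r
  ≤-by {p} d 0≤d refl = subst (_≤ p + d) (ℚₚ.+-identityʳ p) (ℚₚ.+-monoʳ-≤ p 0≤d)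

  ι-mono : ∀ {m n} → m ℕ.≤ n → ι m ≤ ι n
  ι-mono {m} {n} le = ≤-by (ι (n ℕ.∸ m)) (0≤ι (n ℕ.∸ m)) (trans (sym (ι-+ m (n ℕ.∸ m))) (cong ι (ℕₚ.m+[n∸m]≡n le)))

  0≤* : ∀ {p r} → 0ℚ ≤ p → 0ℚ ≤ r → 0ℚ ≤ p * r
  0≤* {p} {r} 0≤p 0≤r = subst (_≤ p * r) (ℚₚ.*-zeroʳ p) (ℚₚ.*-monoˡ-≤-nonNeg p {{nonNegative 0≤p}} 0≤r)

  0≤+ : ∀ {p r} → 0ℚ ≤ p → 0ℚ ≤ r → 0ℚ ≤ p + r
  0≤+ 0≤p 0≤r = ℚₚ.+-mono-≤ 0≤p 0≤r

  *-mono : ∀ {p r} c → 0ℚ ≤ c → p ≤ r → c * p ≤ c * r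
  *-mono c 0≤c = ℚₚ.*-monoˡ-≤-nonNeg c {{nonNegative 0≤c}}

  0≤- : ∀ {p r} → p ≤ r → 0ℚ ≤ r - p
  0≤- {p} {r} le = subst (_≤ r - p) (ℚₚ.+-inverseʳ p) (ℚₚ.+-monoˡ-≤ (- p) le)

  ≤-sub : ∀ {p r} → 0ℚ ≤ r - p → p ≤ r
  ≤-sub {p} {r} h = ≤-by (r - p) h (solve 2 (λ p r → p :+ (r :- p) := r) refl p r)

  half^ : ℕ → ℚ
  half^ zero    = 1ℚ
  half^ (suc n) = ½ * half^ n

  0≤½ : 0ℚ ≤ ½
  0≤½ = ℚₚ.nonNegative⁻¹ ½

  0≤¾ : 0ℚ ≤ ¾
  0≤¾ = ℚₚ.nonNegative⁻¹ ¾

  0≤half^ : ∀ n → 0ℚ ≤ half^ n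
  0≤half^ zero    = ℚₚ.nonNegative⁻¹ 1ℚ
  0≤half^ (suc n) = 0≤* 0≤½ (0≤half^ n)

  half^-+ : ∀ m n → half^ (m ℕ.+ n) ≡ half^ m * half^ n
  half^-+ zero    n = sym (ℚₚ.*-identityˡ _)
  half^-+ (suc m) n = trans (cong (½ *_) (half^-+ m n)) (sym (ℚₚ.*-assoc ½ (half^ m) (half^ n)))

  ι2^*half^ : ∀ n → ι (2 ^ n) * half^ n ≡ 1ℚ
  ι2^*half^ zero    = cong (_* 1ℚ) ι-1
  ι2^*half^ (suc n) = trans (cong (_* (½ * half^ n)) (trans (ι-* 2 (2 ^ n)) (cong (_* ι (2 ^ n)) (ι-def 2))))
    (trans (solve 2 (λ a h → (con (+ 2 / 1) :* a) :* (con ½ :* h) := a :* h) refl (ι (2 ^ n)) (half^ n)) (ι2^*half^ n))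

  /2^-half^ : ∀ m n → m /2^ n ≡ ι m * half^ n
  /2^-half^ m n = begin
    m /2^ n                          ≡⟨ ℚₚ.*-identityˡ _ ⟨
    1ℚ * (m /2^ n)                   ≡⟨ cong (_* (m /2^ n)) (ι2^*half^ n) ⟨
    ι (2 ^ n) * half^ n * (m /2^ n)
      ≡⟨ solve 3 (λ a h x → a :* h :* x := (a :* x) :* h) refl (ι (2 ^ n)) (half^ n) (m /2^ n) ⟩
    ι (2 ^ n) * (m /2^ n) * half^ n  ≡⟨ cong (_* half^ n) (ι-/ m (2 ^ n) {{ℕₚ.m^n≢0 2 n}}) ⟩
    ι m * half^ n                    ∎
    where open ≡-Reasoning

  half^-scale : ∀ a c t → a ℕ.* 4 ℕ.≤ c ℕ.* 2 ^ t → half^ t * ι a ≤ ι c * ¼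
  half^-scale a c t le = begin
    half^ t * ι a
      ≡⟨ solve 2 (λ h a → h :* a := con ¼ :* h :* (a :* con (+ 4 / 1))) refl (half^ t) (ι a) ⟩
    ¼ * half^ t * (ι a * (+ 4 / 1))    ≡⟨ cong (λ x → ¼ * half^ t * (ι a * x)) (ι-def 4) ⟨
    ¼ * half^ t * (ι a * ι 4)          ≡⟨ cong (¼ * half^ t *_) (ι-* a 4) ⟨
    ¼ * half^ t * ι (a ℕ.* 4)          ≤⟨ *-mono (¼ * half^ t) (0≤* 0≤¼ (0≤half^ t)) (ι-mono le) ⟩
    ¼ * half^ t * ι (c ℕ.* 2 ^ t)      ≡⟨ cong (¼ * half^ t *_) (ι-* c (2 ^ t)) ⟩
    ¼ * half^ t * (ι c * ι (2 ^ t))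
      ≡⟨ solve 3 (λ h c p → con ¼ :* h :* (c :* p) := c :* con ¼ :* (p :* h)) refl (half^ t) (ι c) (ι (2 ^ t)) ⟩
    ι c * ¼ * (ι (2 ^ t) * half^ t)    ≡⟨ cong (ι c * ¼ *_) (ι2^*half^ t) ⟩
    ι c * ¼ * 1ℚ                       ≡⟨ ℚₚ.*-identityʳ (ι c * ¼) ⟩
    ι c * ¼                            ∎
    where open ℚₚ.≤-Reasoning

  -- An upper bound expresses convergence to 0 here, as the sequences treated are nonnegative.
  Vanishes : (ℕ → ℚ) → Set
  Vanishes f = ∀ ε → 0ℚ < ε → ∃ λ N → ∀ n → N ℕ.≤ n → f n ≤ ε

  0<½* : ∀ ε → 0ℚ < ε → 0ℚ < ½ * ε
  0<½* ε 0<ε = subst (_< ½ * ε) (ℚₚ.*-zeroʳ ½) (ℚₚ.*-monoʳ-<-pos ½ 0<ε)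

  vanishes-+ : ∀ {f g} → Vanishes f → Vanishes g → Vanishes (λ n → f n + g n)
  vanishes-+ {f} {g} vf vg ε 0<ε with vf (½ * ε) (0<½* ε 0<ε) | vg (½ * ε) (0<½* ε 0<ε)
  ... | N , hf | N′ , hg = N ℕ.⊔ N′ , λ n le → subst (f n + g n ≤_)
    (solve 1 (λ x → con ½ :* x :+ con ½ :* x := x) refl ε)
    (ℚₚ.+-mono-≤ (hf n (ℕₚ.m⊔n≤o⇒m≤o N N′ le)) (hg n (ℕₚ.m⊔n≤o⇒n≤o N N′ le)))

  vanishes-0 : Vanishes (λ _ → 0ℚ)
  vanishes-0 ε 0<ε = 0 , λ _ _ → ℚₚ.<⇒≤ 0<ε

  vanishes-≤ : ∀ {f g} → (∀ n → f n ≤ g n) → Vanishes g → Vanishes f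
  vanishes-≤ le v ε 0<ε with v ε 0<ε
  ... | N , h = N , λ n N≤n → ℚₚ.≤-trans (le n) (h n N≤n)

  vanishes-ι* : ∀ {f} k → Vanishes f → Vanishes (λ n → ι k * f n)
  vanishes-ι* {f} zero v ε 0<ε = 0 , λ n _ → subst (_≤ ε) (sym (trans (cong (_* f n) ι-0) (ℚₚ.*-zeroˡ (f n)))) (ℚₚ.<⇒≤ 0<ε)
  vanishes-ι* {f} (suc k) v = vanishes-≤ (λ n → ℚₚ.≤-reflexive (eq n)) (vanishes-+ {f} {λ n → ι k * f n} v (vanishes-ι* k v))
    where
    eq : ∀ n → ι (suc k) * f n ≡ f n + ι k * f n
    eq n = trans (cong (_* f n) (ι-suc k)) (solve 2 (λ x k → (con 1ℚ :+ k) :* x := x :+ k :* x) refl (f n) (ι k))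

  ¾^ : ℕ → ℚ
  ¾^ zero    = 1ℚ
  ¾^ (suc k) = ¾ * ¾^ k

  0≤¾^ : ∀ k → 0ℚ ≤ ¾^ k
  0≤¾^ zero    = ℚₚ.nonNegative⁻¹ 1ℚ
  0≤¾^ (suc k) = 0≤* 0≤¾ (0≤¾^ k)

  -- Bernoulli's inequality (4/3)^k ≥ 1 + k/3.
  ¾^-bound : ∀ k → ¾^ k * (3ℚ + ι k) ≤ 3ℚ
  ¾^-bound zero    = ℚₚ.≤-reflexive (cong (λ x → 1ℚ * (3ℚ + x)) ι-0)
  ¾^-bound (suc k) = ℚₚ.≤-trans (≤-by (¼ * (ι k * ¾^ k))
      (0≤* 0≤¼ (0≤* (0≤ι k) (0≤¾^ k)))
      (trans (cong (λ x → ¾ * ¾^ k * (3ℚ + x) + ¼ * (ι k * ¾^ k)) (ι-suc k))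
        (solve 2 (λ r k → con ¾ :* r :* (con 3ℚ :+ (con 1ℚ :+ k)) :+ con ¼ :* (k :* r)
                          := r :* (con 3ℚ :+ k)) refl (¾^ k) (ι k))))
    (¾^-bound k)

  archimedean : ∀ ε → 0ℚ < ε → ∃ λ d → 1ℚ ≤ ι d * ε
  archimedean ε 0<ε = ↧ₙ ε , go ε {{positive 0<ε}}
    where
    go : ∀ ε → .{{Positive ε}} → 1ℚ ≤ ι (↧ₙ ε) * ε
    go ε@(mkℚ (+ suc n) d _) = subst₂ _≤_ ι-1
      (sym (trans (cong (ι (suc d) *_) (sym (ℚₚ.↥p/↧p≡p ε))) (ι-/ (suc n) (suc d))))
      (ι-mono {1} {suc n} (s≤s z≤n))

  ¾^-vanishes : Vanishes ¾^
  ¾^-vanishes ε 0<ε with archimedean ε 0<ε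
  -- Bernoulli gives (3/4)^n ≤ 3/(3 + n), which is below 1/d, hence below ε, once n ≥ 3d.
  ... | d , h = 3 ℕ.* d , λ n le → ℚₚ.*-cancelˡ-≤-pos 3ℚ (begin
      3ℚ * ¾^ n                ≡⟨ ℚₚ.*-identityʳ (3ℚ * ¾^ n) ⟨
      3ℚ * ¾^ n * 1ℚ           ≤⟨ *-mono (3ℚ * ¾^ n) (0≤* 0≤3 (0≤¾^ n)) h ⟩
      3ℚ * ¾^ n * (ι d * ε)
        ≡⟨ solve 3 (λ r d e → con 3ℚ :* r :* (d :* e) := (r :* e) :* (con 3ℚ :* d)) refl (¾^ n) (ι d) ε ⟩
      ¾^ n * ε * (3ℚ * ι d)    ≡⟨ cong (λ x → ¾^ n * ε * (x * ι d)) (ι-def 3) ⟨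
      ¾^ n * ε * (ι 3 * ι d)   ≡⟨ cong (¾^ n * ε *_) (ι-* 3 d) ⟨
      ¾^ n * ε * ι (3 ℕ.* d)   ≤⟨ *-mono (¾^ n * ε) (0≤* (0≤¾^ n) (ℚₚ.<⇒≤ 0<ε)) (ι-mono le) ⟩
      ¾^ n * ε * ι n           ≤⟨ ≤-by (3ℚ * (¾^ n * ε)) (0≤* 0≤3 (0≤* (0≤¾^ n) (ℚₚ.<⇒≤ 0<ε)))
                                    (solve 3 (λ r e k → r :* e :* k :+ con 3ℚ :* (r :* e) := e :* (r :* (con 3ℚ :+ k))) refl (¾^ n) ε (ι n)) ⟩
      ε * (¾^ n * (3ℚ + ι n))  ≤⟨ *-mono ε (ℚₚ.<⇒≤ 0<ε) (¾^-bound n) ⟩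
      ε * 3ℚ                   ≡⟨ ℚₚ.*-comm ε 3ℚ ⟩
      3ℚ * ε                   ∎)
    where
    open ℚₚ.≤-Reasoning
    0≤3 : 0ℚ ≤ 3ℚ
    0≤3 = ℚₚ.nonNegative⁻¹ 3ℚ

  -- The perturbation e/8 has e/2 as the fixed point of z ↦ 3z/4 + e/8; only the excess `r` over it
  -- shrinks.
  contraction-step : ∀ {x y} e r → x ≤ ½ * e + r → y ≤ ½ * (½ * (½ * e)) → ¾ * x + y ≤ ½ * e + ¾ * r
  contraction-step {x} {y} e r hx hy = subst (¾ * x + y ≤_)
    (solve 2 (λ e r → con ¾ :* (con ½ :* e :+ r) :+ con ½ :* (con ½ :* (con ½ :* e)) := con ½ :* e :+ con ¾ :* r) refl e r)
    (ℚₚ.+-mono-≤ {¾ * x} {¾ * (½ * e + r)} {y} (*-mono ¾ 0≤¾ hx) hy)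

  contraction-bound : ∀ {f g : ℕ → ℚ} {ε} s N → 0ℚ ≤ ½ * ε → (∀ n → f n ≤ 1ℚ) → (∀ n → f (s ℕ.+ n) ≤ ¾ * f n + g n) →
    (∀ n → N ℕ.≤ n → g n ≤ ½ * (½ * (½ * ε))) → ∀ k n → k ℕ.* s ℕ.+ N ℕ.≤ n → f n ≤ ½ * ε + ¾^ k
  contraction-bound {f} {g} {ε} s N 0≤½ε f≤1 rec small zero n le =
    ℚₚ.≤-trans (f≤1 n) (≤-by {1ℚ} {½ * ε + 1ℚ} (½ * ε) 0≤½ε (ℚₚ.+-comm 1ℚ (½ * ε)))
  contraction-bound {f} {g} {ε} s N 0≤½ε f≤1 rec small (suc k) n le =
    subst (λ n → f n ≤ ½ * ε + ¾ * ¾^ k) (ℕₚ.m+[n∸m]≡n s≤n)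
      (ℚₚ.≤-trans (rec n′) (contraction-step {f n′} {g n′} ε (¾^ k)
        (contraction-bound {f} {g} {ε} s N 0≤½ε f≤1 rec small k n′ le′)
        (small n′ (ℕₚ.≤-trans (ℕₚ.m≤n+m N (k ℕ.* s)) le′))))
    where
    s≤n : s ℕ.≤ n
    s≤n = ℕₚ.≤-trans (ℕₚ.m≤m+n s (k ℕ.* s)) (ℕₚ.≤-trans (ℕₚ.m≤m+n _ N) le)
    n′ = n ℕ.∸ s
    le′ : k ℕ.* s ℕ.+ N ℕ.≤ n′
    le′ = subst (ℕ._≤ n′) (ℕₚ.m+n∸m≡n s _) (ℕₚ.∸-monoˡ-≤ s (subst (ℕ._≤ n) (ℕₚ.+-assoc s (k ℕ.* s) N) le))

  halves : ∀ ε → ½ * ε + ½ * ε ≡ ε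
  halves = solve 1 (λ x → con ½ :* x :+ con ½ :* x := x) refl

  contraction : ∀ {f g : ℕ → ℚ} s → (∀ n → f n ≤ 1ℚ) → (∀ n → f (s ℕ.+ n) ≤ ¾ * f n + g n) → Vanishes g → Vanishes f
  contraction {f} {g} s f≤1 rec vg ε 0<ε =
    let 0<½ε = 0<½* ε 0<ε
        (N , small) = vg (½ * (½ * (½ * ε))) (0<½* (½ * (½ * ε)) (0<½* (½ * ε) 0<½ε))
        (k , r) = ¾^-vanishes (½ * ε) 0<½ε
    in k ℕ.* s ℕ.+ N , λ n le → subst (f n ≤_) (halves ε)
         (ℚₚ.≤-trans (contraction-bound {f} {g} {ε} s N (ℚₚ.<⇒≤ 0<½ε) f≤1 rec small k n le)
                     (ℚₚ.+-monoʳ-≤ (½ * ε) (r k ℕₚ.≤-refl)))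

  -- The limit

  ∑ : ℕ → (ℕ → ℚ) → ℚ
  ∑ zero    f = 0ℚ
  ∑ (suc k) f = ∑ k f + f k

  ∑-cong : ∀ k {f g : ℕ → ℚ} → (∀ t → f t ≡ g t) → ∑ k f ≡ ∑ k g
  ∑-cong zero    h = refl
  ∑-cong (suc k) h = cong₂ _+_ (∑-cong k h) (h k)

  0≤∑ : ∀ k {f : ℕ → ℚ} → (∀ t → 0ℚ ≤ f t) → 0ℚ ≤ ∑ k f
  0≤∑ zero        h = ℚₚ.≤-refl
  0≤∑ (suc k) {f} h = 0≤+ {∑ k f} {f k} (0≤∑ k h) (h k)

  ∑-extend : ∀ k d {f : ℕ → ℚ} → (∀ t → 0ℚ ≤ f t) → ∑ k f ≤ ∑ (d ℕ.+ k) f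
  ∑-extend k zero        h = ℚₚ.≤-refl
  ∑-extend k (suc d) {f} h = ℚₚ.≤-trans (∑-extend k d {f} h)
    (≤-by {∑ (d ℕ.+ k) f} {∑ (suc d ℕ.+ k) f} (f (d ℕ.+ k)) (h (d ℕ.+ k)) refl)

  ∑-distrib : ∀ k (f g : ℕ → ℚ) → ∑ k (λ t → f t + g t) ≡ ∑ k f + ∑ k g
  ∑-distrib zero    f g = refl
  ∑-distrib (suc k) f g = trans (cong (_+ (f k + g k)) (∑-distrib k f g))
    (solve 4 (λ a b c d → a :+ b :+ (c :+ d) := a :+ c :+ (b :+ d)) refl (∑ k f) (∑ k g) (f k) (g k))

  vanishes-∑ : ∀ k {f : ℕ → ℕ → ℚ} → (∀ t → Vanishes (f t)) → Vanishes (λ n → ∑ k (λ t → f t n))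
  vanishes-∑ zero        v = vanishes-0
  vanishes-∑ (suc k) {f} v = vanishes-+ {λ n → ∑ k (λ t → f t n)} {f k} (vanishes-∑ k v) (v k)

  -- The summand (t+1) q_t of γ, indexed from 0.
  a : ℕ → ℚ
  a t = ι (2 ℕ.+ t) * q (suc t)

  S-∑ : ∀ t → S t ≡ ∑ t a
  S-∑ zero    = refl
  S-∑ (suc t) = cong₂ (λ x y → x + y * q (suc t)) (S-∑ t) (trans (sym (ι-def (t ℕ.+ 2))) (cong ι (ℕₚ.+-comm t 2)))

  den*q : ∀ k → ι (den k) * q (2 ℕ.+ k) ≡ ι (1 ℕ.+ k) * q (1 ℕ.+ k)
  den*q k = begin
    ι (den k) * (q (suc k) * factor k)
      ≡⟨ solve 3 (λ d x f → d :* (x :* f) := d :* f :* x) refl (ι (den k)) (q (suc k)) (factor k) ⟩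
    ι (den k) * factor k * q (suc k)    ≡⟨ cong (_* q (suc k)) (ι-/ (k ℕ.+ 1) (den k) {{den-nz k}}) ⟩
    ι (k ℕ.+ 1) * q (suc k)             ≡⟨ cong (λ x → ι x * q (suc k)) (ℕₚ.+-comm k 1) ⟩
    ι (1 ℕ.+ k) * q (suc k)             ∎
    where open ≡-Reasoning

  -- The part `3 + k` subtracted in `den k`, moved to the other side of `den*q`, supplies the first
  -- summand.
  q-rec : ∀ k → q (2 ℕ.+ k) ≡ half^ (2 ℕ.+ k) * (ι (3 ℕ.+ k) * q (2 ℕ.+ k) + ι (1 ℕ.+ k) * q (1 ℕ.+ k))
  q-rec k = begin
    x                                                 ≡⟨ ℚₚ.*-identityˡ x ⟨
    1ℚ * x                                            ≡⟨ cong (_* x) (ι2^*half^ (2 ℕ.+ k)) ⟨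
    ι (2 ^ (2 ℕ.+ k)) * h * x
      ≡⟨ cong (λ y → y * h * x) (trans (cong ι (sym (den-+ k))) (ι-+ (den k) (3 ℕ.+ k))) ⟩
    (ι (den k) + ι (3 ℕ.+ k)) * h * x
      ≡⟨ solve 4 (λ d c h x → (d :+ c) :* h :* x := h :* (c :* x :+ d :* x)) refl (ι (den k)) (ι (3 ℕ.+ k)) h x ⟩
    h * (ι (3 ℕ.+ k) * x + ι (den k) * x)             ≡⟨ cong (λ y → h * (ι (3 ℕ.+ k) * x + y)) (den*q k) ⟩
    h * (ι (3 ℕ.+ k) * x + ι (1 ℕ.+ k) * q (1 ℕ.+ k)) ∎
    where
    open ≡-Reasoning
    x h : ℚ
    x = q (2 ℕ.+ k)
    h = half^ (2 ℕ.+ k)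

  0≤q : ∀ t → 0ℚ ≤ q (suc t)
  0≤q zero    = 0≤½
  0≤q (suc k) = 0≤* {q (suc k)} {factor k} (0≤q k)
    (ℚₚ.nonNegative⁻¹ (factor k) {{ℚₚ.normalize-nonNeg (k ℕ.+ 1) (den k) {{den-nz k}}}})

  mix : ∀ k x y → 0ℚ ≤ x → 0ℚ ≤ y →
        half^ (2 ℕ.+ k) * (ι (3 ℕ.+ k) * x + ι (1 ℕ.+ k) * y) ≤ ¾ * x + ¼ * y
  mix k x y 0≤x 0≤y = subst (_≤ ¾ * x + ¼ * y)
    (solve 5 (λ h c d x y → h :* c :* x :+ h :* d :* y := h :* (c :* x :+ d :* y)) refl h (ι (3 ℕ.+ k)) (ι (1 ℕ.+ k)) x y)
    (ℚₚ.+-mono-≤ {h * ι (3 ℕ.+ k) * x} {¾ * x} {h * ι (1 ℕ.+ k) * y} {¼ * y}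
      (ℚₚ.*-monoʳ-≤-nonNeg x {{nonNegative 0≤x}}
        (subst (h * ι (3 ℕ.+ k) ≤_) (cong (_* ¼) (ι-def 3)) (half^-scale (3 ℕ.+ k) 3 (2 ℕ.+ k) (scale₃ k))))
      (ℚₚ.*-monoʳ-≤-nonNeg y {{nonNegative 0≤y}}
        (subst (h * ι (1 ℕ.+ k) ≤_) (cong (_* ¼) ι-1) (half^-scale (1 ℕ.+ k) 1 (2 ℕ.+ k) (scale₁ k)))))
    where
    h : ℚ
    h = half^ (2 ℕ.+ k)

  -- By `q-rec` and `mix`, x ≤ 3x/4 + y/4; absorbing 3x/4 leaves x/4 ≤ y/4.
  q-decreasing : ∀ k → q (2 ℕ.+ k) ≤ q (1 ℕ.+ k)
  q-decreasing k = ℚₚ.*-cancelˡ-≤-pos ¼ (≤-sub {¼ * x} {¼ * y} (subst (0ℚ ≤_)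
      (solve 2 (λ x y → con ¾ :* x :+ con ¼ :* y :- x := con ¼ :* y :- con ¼ :* x) refl x y)
      (0≤- {x} {¾ * x + ¼ * y} (subst (_≤ ¾ * x + ¼ * y) (sym (q-rec k)) (mix k x y (0≤q (suc k)) (0≤q k))))))
    where
    x y : ℚ
    x = q (2 ℕ.+ k)
    y = q (1 ℕ.+ k)

  q≤1 : ∀ t → q (suc t) ≤ 1ℚ
  q≤1 zero    = ≤-by {½} {1ℚ} ½ 0≤½ refl
  q≤1 (suc t) = ℚₚ.≤-trans (q-decreasing t) (q≤1 t)

  -- The normalised numbers of cycles with t chains that avoid 0 (u) or visit it (w, up to
  -- the factor t), and their defects from the limit q t.
  u w e g : ℕ → ℕ → ℚ
  u t n = ι (b t n) * half^ n
  w t n = ι (sum< n (b t)) * half^ n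
  e t n = q t - u t n
  g t n = q t - w t n

  0≤u : ∀ t n → 0ℚ ≤ u t n
  0≤u t n = 0≤* {ι (b t n)} {half^ n} (0≤ι _) (0≤half^ n)

  0≤w : ∀ t n → 0ℚ ≤ w t n
  0≤w t n = 0≤* {ι (sum< n (b t))} {half^ n} (0≤ι _) (0≤half^ n)

  sub≤1 : ∀ t x → 0ℚ ≤ x → q (suc t) - x ≤ 1ℚ
  sub≤1 t x 0≤x = ℚₚ.≤-trans (≤-by {q (suc t) - x} {q (suc t)} x 0≤x
    (solve 2 (λ a x → a :- x :+ x := a) refl (q (suc t)) x)) (q≤1 t)

  u-rec : ∀ k n → u (2 ℕ.+ k) (2 ℕ.+ k ℕ.+ n) ≡
          half^ (2 ℕ.+ k) * (ι (3 ℕ.+ k) * u (2 ℕ.+ k) n + ι (1 ℕ.+ k) * u (1 ℕ.+ k) n)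
  u-rec k n = trans (cong₂ (λ x y → x * y)
      (trans (cong ι (b-rec k n)) (trans (ι-+ (c₃ ℕ.* x) (c₁ ℕ.* y)) (cong₂ _+_ (ι-* c₃ x) (ι-* c₁ y))))
      (half^-+ (2 ℕ.+ k) n))
    (solve 6 (λ c x d y h l → (c :* x :+ d :* y) :* (h :* l) := h :* (c :* (x :* l) :+ d :* (y :* l))) refl
       (ι c₃) (ι x) (ι c₁) (ι y) (half^ (2 ℕ.+ k)) (half^ n))
    where
    c₃ c₁ x y : ℕ
    c₃ = 3 ℕ.+ k
    c₁ = 1 ℕ.+ k
    x = b (2 ℕ.+ k) n
    y = b (1 ℕ.+ k) n

  e-rec : ∀ k n → e (2 ℕ.+ k) (2 ℕ.+ k ℕ.+ n) ≡
          half^ (2 ℕ.+ k) * (ι (3 ℕ.+ k) * e (2 ℕ.+ k) n + ι (1 ℕ.+ k) * e (1 ℕ.+ k) n)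
  e-rec k n = trans (cong₂ (λ x y → x - y) (q-rec k) (u-rec k n))
    (solve 7 (λ h c d x y x′ y′ → h :* (c :* x :+ d :* y) :- h :* (c :* x′ :+ d :* y′)
                                  := h :* (c :* (x :- x′) :+ d :* (y :- y′))) refl
      (half^ (2 ℕ.+ k)) (ι (3 ℕ.+ k)) (ι (1 ℕ.+ k)) (q (2 ℕ.+ k)) (q (1 ℕ.+ k)) (u (2 ℕ.+ k) n) (u (1 ℕ.+ k) n))

  e-1 : ∀ n → e 1 (suc n) ≡ 0ℚ
  e-1 n = begin
    ½ - ι (b 1 (suc n)) * (½ * half^ n)  ≡⟨ cong (λ x → ½ - ι x * (½ * half^ n)) (b-1 n) ⟩
    ½ - ι (2 ^ n) * (½ * half^ n)
      ≡⟨ solve 2 (λ x h → con ½ :- x :* (con ½ :* h) := con ½ :- con ½ :* (x :* h)) refl (ι (2 ^ n)) (half^ n) ⟩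
    ½ - ½ * (ι (2 ^ n) * half^ n)        ≡⟨ cong (λ x → ½ - ½ * x) (ι2^*half^ n) ⟩
    0ℚ                                   ∎
    where open ≡-Reasoning

  u-zero : ∀ t n → b t n ≡ 0 → e t n ≡ q t
  u-zero t n eq = trans (cong (λ x → q t - x * half^ n) (trans (cong ι eq) ι-0))
    (solve 2 (λ a h → a :- con 0ℚ :* h := a) refl (q t) (half^ n))

  -- Induction on the number of chains, and for each number on `n` in steps of that size; below the
  -- first step no cycles exist and the defect is `q` itself.
  0≤e : ∀ t n → 0ℚ ≤ e (suc t) n
  0≤e zero    zero    = subst (0ℚ ≤_) (sym (u-zero 1 0 refl)) 0≤½
  0≤e zero    (suc n) = ℚₚ.≤-reflexive (sym (e-1 n))
  0≤e (suc k)         = step-induction {λ n → 0ℚ ≤ e (2 ℕ.+ k) n} (suc k)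
    (λ n lt → subst (0ℚ ≤_) (sym (u-zero (2 ℕ.+ k) n (b-small k n lt))) (0≤q (suc k)))
    (λ n ih → subst (0ℚ ≤_) (sym (e-rec k n))
      (0≤* {half^ (2 ℕ.+ k)} {ι (3 ℕ.+ k) * e (2 ℕ.+ k) n + ι (1 ℕ.+ k) * e (1 ℕ.+ k) n} (0≤half^ (2 ℕ.+ k))
        (0≤+ {ι (3 ℕ.+ k) * e (2 ℕ.+ k) n} {ι (1 ℕ.+ k) * e (1 ℕ.+ k) n}
          (0≤* {ι (3 ℕ.+ k)} {e (2 ℕ.+ k) n} (0≤ι _) ih)
          (0≤* {ι (1 ℕ.+ k)} {e (1 ℕ.+ k) n} (0≤ι _) (0≤e k n)))))

  e-vanishes : ∀ t → Vanishes (e (suc t))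
  e-vanishes zero ε 0<ε = 1 , λ { (suc n) _ → subst (_≤ ε) (sym (e-1 n)) (ℚₚ.<⇒≤ 0<ε) }
  e-vanishes (suc k) = contraction {e (2 ℕ.+ k)} {e (1 ℕ.+ k)} (2 ℕ.+ k)
    (λ n → sub≤1 (suc k) (u (2 ℕ.+ k) n) (0≤u (2 ℕ.+ k) n))
    (λ n → ℚₚ.≤-trans (subst (_≤ ¾ * e (2 ℕ.+ k) n + ¼ * e (1 ℕ.+ k) n) (sym (e-rec k n))
                        (mix k (e (2 ℕ.+ k) n) (e (1 ℕ.+ k) n) (0≤e (suc k) n) (0≤e k n)))
      (≤-by {¾ * e (2 ℕ.+ k) n + ¼ * e (1 ℕ.+ k) n} {¾ * e (2 ℕ.+ k) n + e (1 ℕ.+ k) n}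
        (¾ * e (1 ℕ.+ k) n) (0≤* {¾} {e (1 ℕ.+ k) n} 0≤¾ (0≤e k n))
        (solve 2 (λ x y → con ¾ :* x :+ con ¼ :* y :+ con ¾ :* y := con ¾ :* x :+ y) refl (e (2 ℕ.+ k) n) (e (1 ℕ.+ k) n))))
    (e-vanishes k)

  -- Adding one term to the sum while halving the scale averages the two defects; this is why the
  -- sums over m < n have the same limit `q t` as the terms.
  g-rec : ∀ t n → g t (suc n) ≡ ½ * (g t n + e t n)
  g-rec t n = trans (cong (λ x → q t - x * (½ * half^ n)) (ι-+ (sum< n (b t)) (b t n)))
    (solve 4 (λ a x y h → a :- (x :+ y) :* (con ½ :* h) := con ½ :* (a :- x :* h :+ (a :- y :* h))) refl
      (q t) (ι (sum< n (b t))) (ι (b t n)) (half^ n))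

  0≤g : ∀ t n → 0ℚ ≤ g (suc t) n
  0≤g t zero    = subst (0ℚ ≤_) (sym (trans (cong (λ x → q (suc t) - x * 1ℚ) ι-0)
    (solve 1 (λ a → a :- con 0ℚ :* con 1ℚ := a) refl (q (suc t))))) (0≤q t)
  0≤g t (suc n) = subst (0ℚ ≤_) (sym (g-rec (suc t) n))
    (0≤* {½} {g (suc t) n + e (suc t) n} 0≤½ (0≤+ {g (suc t) n} {e (suc t) n} (0≤g t n) (0≤e t n)))

  ½-≤-¾ : ∀ x y → 0ℚ ≤ x → 0ℚ ≤ y → ½ * (x + y) ≤ ¾ * x + y
  ½-≤-¾ x y 0≤x 0≤y = ≤-by {½ * (x + y)} {¾ * x + y} (¼ * x + ½ * y)
    (0≤+ {¼ * x} {½ * y} (0≤* {¼} {x} 0≤¼ 0≤x) (0≤* {½} {y} 0≤½ 0≤y))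
    (solve 2 (λ x y → con ½ :* (x :+ y) :+ (con ¼ :* x :+ con ½ :* y) := con ¾ :* x :+ y) refl x y)

  g-vanishes : ∀ t → Vanishes (g (suc t))
  g-vanishes t = contraction {g (suc t)} {e (suc t)} 1
    (λ n → sub≤1 t (w (suc t) n) (0≤w (suc t) n))
    (λ n → subst (_≤ ¾ * g (suc t) n + e (suc t) n) (sym (g-rec (suc t) n))
             (½-≤-¾ (g (suc t) n) (e (suc t) n) (0≤g t n) (0≤e t n)))
    (e-vanishes t)

  halving-vanishes : ∀ {f : ℕ → ℚ} → (∀ n → 0ℚ ≤ f n) → f 0 ≤ 1ℚ → (∀ n → f (suc n) ≤ ½ * f n) → Vanishes f
  halving-vanishes {f} 0≤f f0 half = contraction {f} {λ _ → 0ℚ} 1 f≤1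
    (λ n → ℚₚ.≤-trans (half n) (subst (λ x → ½ * x ≤ ¾ * f n + 0ℚ) (ℚₚ.+-identityʳ (f n)) (½-≤-¾ (f n) 0ℚ (0≤f n) ℚₚ.≤-refl)))
    vanishes-0
    where
    f≤1 : ∀ n → f n ≤ 1ℚ
    f≤1 zero    = f0
    f≤1 (suc n) = ℚₚ.≤-trans (half n) (ℚₚ.≤-trans
      (≤-by {½ * f n} {f n} (½ * f n) (0≤* {½} {f n} 0≤½ (0≤f n)) (halves (f n))) (f≤1 n))

  half^-vanishes : Vanishes half^
  half^-vanishes = halving-vanishes {half^} 0≤half^ ℚₚ.≤-refl (λ n → ℚₚ.≤-refl)

  -- The tail of the series γ

  0≤a : ∀ t → 0ℚ ≤ a t
  0≤a t = 0≤* {ι (2 ℕ.+ t)} {q (suc t)} (0≤ι _) (0≤q t)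

  -- The ratio is (5 + j)(3 + j) / ((4 + j) den (2 + j)). Halving fails one place earlier, where
  -- `a 1` is 3/2 and `a 2` is 1; hence the offset 2 in the tail estimates.
  a-halves : ∀ j → a (3 ℕ.+ j) ≤ ½ * a (2 ℕ.+ j)
  a-halves j = ℚₚ.*-cancelˡ-≤-pos c {{positive 0<c}} (begin
    c * (ι (5 ℕ.+ j) * x)
      ≡⟨ solve 3 (λ c d x → c :* (d :* x) := con ½ :* (con (+ 2 / 1) :* d :* c :* x)) refl c (ι (5 ℕ.+ j)) x ⟩
    ½ * ((+ 2 / 1) * ι (5 ℕ.+ j) * c * x)
      ≡⟨ cong (λ y → ½ * (y * x)) (sym (trans (ι-* (2 ℕ.* (5 ℕ.+ j)) (3 ℕ.+ j))
        (cong (_* c) (trans (ι-* 2 (5 ℕ.+ j)) (cong (_* ι (5 ℕ.+ j)) (ι-def 2)))))) ⟩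
    ½ * (ι (2 ℕ.* (5 ℕ.+ j) ℕ.* (3 ℕ.+ j)) * x)
      ≤⟨ *-mono ½ 0≤½ (ℚₚ.*-monoʳ-≤-nonNeg x {{nonNegative (0≤q (3 ℕ.+ j))}} (ι-mono (den-bound j))) ⟩
    ½ * (ι ((4 ℕ.+ j) ℕ.* den (2 ℕ.+ j)) * x)         ≡⟨ cong (λ y → ½ * (y * x)) (ι-* (4 ℕ.+ j) (den (2 ℕ.+ j))) ⟩
    ½ * (ι (4 ℕ.+ j) * ι (den (2 ℕ.+ j)) * x)
      ≡⟨ cong (½ *_) (ℚₚ.*-assoc (ι (4 ℕ.+ j)) (ι (den (2 ℕ.+ j))) x) ⟩
    ½ * (ι (4 ℕ.+ j) * (ι (den (2 ℕ.+ j)) * x))       ≡⟨ cong (λ y → ½ * (ι (4 ℕ.+ j) * y)) (den*q (2 ℕ.+ j)) ⟩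
    ½ * (ι (4 ℕ.+ j) * (c * q (3 ℕ.+ j)))
      ≡⟨ solve 3 (λ d c x → con ½ :* (d :* (c :* x)) := c :* (con ½ :* (d :* x))) refl (ι (4 ℕ.+ j)) c (q (3 ℕ.+ j)) ⟩
    c * (½ * (ι (4 ℕ.+ j) * q (3 ℕ.+ j)))             ∎)
    where
    open ℚₚ.≤-Reasoning
    c x : ℚ
    c = ι (3 ℕ.+ j)
    x = q (4 ℕ.+ j)
    0<c : 0ℚ < c
    0<c = ℚₚ.<-≤-trans (ℚₚ.positive⁻¹ 1ℚ) (subst (_≤ c) ι-1 (ι-mono {1} {3 ℕ.+ j} (s≤s z≤n)))

  a-vanishes : Vanishes (λ k → a (2 ℕ.+ k))
  a-vanishes = halving-vanishes {λ k → a (2 ℕ.+ k)} (λ k → 0≤a (2 ℕ.+ k))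
    -- The initial value `a 2` is 4 times 1/4, exactly 1.
    (ℚₚ.≤-reflexive (cong (_* q 3) (ι-def 4))) a-halves

  -- Partial sum plus twice the next term never increases: halving gives `a n` + 2 `a (n + 1)` ≤ 2
  -- `a n`.
  tail : ∀ T d → ∑ (d ℕ.+ (2 ℕ.+ T)) a + (a (d ℕ.+ (2 ℕ.+ T)) + a (d ℕ.+ (2 ℕ.+ T))) ≤
                 ∑ (2 ℕ.+ T) a + (a (2 ℕ.+ T) + a (2 ℕ.+ T))
  tail T zero    = ℚₚ.≤-refl
  tail T (suc d) = ℚₚ.≤-trans (add-halved (∑ n a) (a n) (a (suc n)) (half d)) (tail T d)
    where
    n : ℕ
    n = d ℕ.+ (2 ℕ.+ T)
    add-halved : ∀ s x y → y ≤ ½ * x → s + x + (y + y) ≤ s + (x + x)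
    add-halved s x y h = ≤-sub {s + x + (y + y)} {s + (x + x)} (subst (0ℚ ≤_)
      (solve 3 (λ s x y → (con ½ :* x :- y) :+ (con ½ :* x :- y) := s :+ (x :+ x) :- (s :+ x :+ (y :+ y))) refl s x y)
      (0≤+ {½ * x - y} {½ * x - y} (0≤- {y} {½ * x} h) (0≤- {y} {½ * x} h)))
    half : ∀ d → a (suc (d ℕ.+ (2 ℕ.+ T))) ≤ ½ * a (d ℕ.+ (2 ℕ.+ T))
    half d = subst (λ m → a (suc m) ≤ ½ * a m)
      (trans (cong (2 ℕ.+_) (ℕₚ.+-comm T d)) (trans (sym (ℕₚ.+-assoc 2 d T))
        (trans (cong (ℕ._+ T) (ℕₚ.+-comm 2 d)) (ℕₚ.+-assoc d 2 T))))
      (a-halves (T ℕ.+ d))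

  S-tail : ∀ T t → 2 ℕ.+ T ℕ.≤ t → S t ≤ S (2 ℕ.+ T) + (a (2 ℕ.+ T) + a (2 ℕ.+ T))
  S-tail T t le = subst₂ (λ x y → x ≤ y + (a (2 ℕ.+ T) + a (2 ℕ.+ T))) (sym (S-∑ t)) (sym (S-∑ (2 ℕ.+ T)))
    (subst (λ m → ∑ m a ≤ ∑ (2 ℕ.+ T) a + (a (2 ℕ.+ T) + a (2 ℕ.+ T))) (ℕₚ.m∸n+n≡m le)
      (ℚₚ.≤-trans (≤-by {∑ n a} {∑ n a + (a n + a n)} (a n + a n)
        (0≤+ {a n} {a n} (0≤a n) (0≤a n)) refl) (tail T (t ℕ.∸ (2 ℕ.+ T)))))
    where
    n : ℕ
    n = (t ℕ.∸ (2 ℕ.+ T)) ℕ.+ (2 ℕ.+ T)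

  S-mono : ∀ T t → T ℕ.≤ t → S T ≤ S t
  S-mono T t le = subst₂ _≤_ (sym (S-∑ T)) (trans (cong (λ m → ∑ m a) (ℕₚ.m∸n+n≡m le)) (sym (S-∑ t)))
    (∑-extend T (t ℕ.∸ T) {a} 0≤a)

  -- The contribution of t + 1 chains to M′(n,2)/2^n, and its defect from a t.
  x d : ℕ → ℕ → ℚ
  x n t = u (suc t) n + ι (suc t) * w (suc t) n
  d n t = e (suc t) n + ι (suc t) * g (suc t) n

  0≤x : ∀ n t → 0ℚ ≤ x n t
  0≤x n t = 0≤+ {u (suc t) n} {ι (suc t) * w (suc t) n} (0≤u (suc t) n)
    (0≤* {ι (suc t)} {w (suc t) n} (0≤ι (suc t)) (0≤w (suc t) n))

  0≤d : ∀ n t → 0ℚ ≤ d n t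
  0≤d n t = 0≤+ {e (suc t) n} {ι (suc t) * g (suc t) n} (0≤e t n)
    (0≤* {ι (suc t)} {g (suc t) n} (0≤ι (suc t)) (0≤g t n))

  x+d : ∀ n t → x n t + d n t ≡ a t
  x+d n t = trans
    (solve 4 (λ c q u w → u :+ c :* w :+ (q :- u :+ c :* (q :- w)) := (con 1ℚ :+ c) :* q) refl
      (ι (suc t)) (q (suc t)) (u (suc t) n) (w (suc t) n))
    (cong (_* q (suc t)) (sym (ι-suc (suc t))))

  d-vanishes : ∀ t → Vanishes (λ n → d n t)
  d-vanishes t = vanishes-+ {e (suc t)} {λ n → ι (suc t) * g (suc t) n} (e-vanishes t)
    (vanishes-ι* {g (suc t)} (suc t) (g-vanishes t))

  ∑x+∑d : ∀ n k → ∑ k (x n) + ∑ k (d n) ≡ S k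
  ∑x+∑d n k = trans (sym (∑-distrib k (x n) (d n))) (trans (∑-cong k (x+d n)) (sym (S-∑ k)))

  ι-sum< : ∀ k (f g : ℕ → ℕ) h →
           ι (sum< k f ℕ.+ sum< k g) * h ≡ ∑ k (λ t → ι (f t) * h + ι (g t) * h)
  ι-sum< zero    f g h = trans (cong (_* h) ι-0) (ℚₚ.*-zeroˡ h)
  ι-sum< (suc k) f g h = begin
    ι (sum< k f ℕ.+ f k ℕ.+ (sum< k g ℕ.+ g k)) * h
      ≡⟨ cong (λ y → ι y * h) (lemma (sum< k f) (f k) (sum< k g) (g k)) ⟩
    ι (sum< k f ℕ.+ sum< k g ℕ.+ (f k ℕ.+ g k)) * h
      ≡⟨ cong (_* h) (trans (ι-+ (sum< k f ℕ.+ sum< k g) (f k ℕ.+ g k))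
        (cong (_+_ (ι (sum< k f ℕ.+ sum< k g))) (ι-+ (f k) (g k)))) ⟩
    (ι (sum< k f ℕ.+ sum< k g) + (ι (f k) + ι (g k))) * h
      ≡⟨ solve 4 (λ s x y h → (s :+ (x :+ y)) :* h := s :* h :+ (x :* h :+ y :* h)) refl (ι (sum< k f ℕ.+ sum< k g)) (ι (f k)) (ι (g k)) h ⟩
    ι (sum< k f ℕ.+ sum< k g) * h + (ι (f k) * h + ι (g k) * h)
      ≡⟨ cong (_+ (ι (f k) * h + ι (g k) * h)) (ι-sum< k f g h) ⟩
    ∑ (suc k) (λ t → ι (f t) * h + ι (g t) * h)             ∎
    where
    open ≡-Reasoning
    lemma : ∀ a b c d → a ℕ.+ b ℕ.+ (c ℕ.+ d) ≡ a ℕ.+ c ℕ.+ (b ℕ.+ d)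
    lemma = solve-∀

  density : ∀ n → fullCount n /2^ n ≡ half^ n + ∑ n (x n)
  density n = begin
    fullCount n /2^ n                    ≡⟨ /2^-half^ (fullCount n) n ⟩
    ι (fullCount n) * h                  ≡⟨ cong (λ y → ι y * h) (fullCount-b n) ⟩
    ι (suc s) * h                        ≡⟨ cong (_* h) (ι-suc s) ⟩
    (1ℚ + ι s) * h                       ≡⟨ solve 2 (λ s h → (con 1ℚ :+ s) :* h := h :+ s :* h) refl (ι s) h ⟩
    h + ι s * h                          ≡⟨ cong (_+_ h) (ι-sum< n _ _ h) ⟩
    h + ∑ n (λ t → ι (b (suc t) n) * h + ι (suc t ℕ.* sum< n (b (suc t))) * h)
      ≡⟨ cong (_+_ h) (∑-cong n (λ t → cong (_+_ (u (suc t) n))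
        (trans (cong (_* h) (ι-* (suc t) (sum< n (b (suc t))))) (ℚₚ.*-assoc (ι (suc t)) (ι (sum< n (b (suc t)))) h)))) ⟩
    h + ∑ n (x n)                        ∎
    where
    open ≡-Reasoning
    h : ℚ
    h = half^ n
    s : ℕ
    s = sum< n (λ t → b (suc t) n) ℕ.+ sum< n (λ t → suc t ℕ.* sum< n (b (suc t)))

  -- Uniform comparison with the partial sums

  ∣∣≤ : ∀ {y ε} → y ≤ ε → - y ≤ ε → ∣ y ∣ ≤ ε
  ∣∣≤ {y} {ε} h h′ with ℚₚ.∣p∣≡p∨∣p∣≡-p y
  ... | inj₁ eq = subst (_≤ ε) (sym eq) h
  ... | inj₂ eq = subst (_≤ ε) (sym eq) h′

  -- `X` and `D` collect density and defect for at most `T` chains, `Y` is the density without `h`,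
  -- and `r` bounds the tail. Both `s` and `Y` lie between `X` and `X + D + r`, and `s` is at least
  -- `X + D`, so the difference is at most `h + r` one way and `D + r` the other.
  squeeze : ∀ h X D Y s sₙ r ε → 0ℚ ≤ h → 0ℚ ≤ D → X ≤ Y → Y ≤ sₙ → sₙ ≤ X + D + r →
            X + D ≤ s → s ≤ X + D + r → D + h ≤ ½ * ε → r ≤ ½ * ε → ∣ h + Y - s ∣ ≤ ε
  squeeze h X D Y s sₙ r ε 0≤h 0≤D X≤Y Y≤sₙ sₙ≤ ≤s s≤ Dh≤ r≤ = ∣∣≤ {h + Y - s} {ε}
    (≤-by {h + Y - s} {ε} gap₁
      (0≤+ {p₁ + p₂ + p₃ + p₄ + p₅} {D} (0≤+ {p₁ + p₂ + p₃ + p₄} {p₅} (0≤+ {p₁ + p₂ + p₃} {p₄}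
        (0≤+ {p₁ + p₂} {p₃} (0≤+ {p₁} {p₂} 0≤p₁ 0≤p₂) (0≤- {sₙ} {X + D + r} sₙ≤)) (0≤- {Y} {sₙ} Y≤sₙ)) (0≤- {X + D} {s} ≤s)) 0≤D)
      (solve 8 (λ h X D Y s sₙ r ε → h :+ Y :- s :+ ((con ½ :* ε :- (D :+ h)) :+ (con ½ :* ε :- r) :+ (X :+ D :+ r :- sₙ) :+
        (sₙ :- Y) :+ (s :- (X :+ D)) :+ D) := ε)
        refl h X D Y s sₙ r ε))
    (≤-by { - (h + Y - s)} {ε} gap₂
      (0≤+ {p₁ + p₂ + p₆ + p₇} {h + h} (0≤+ {p₁ + p₂ + p₆} {p₇} (0≤+ {p₁ + p₂} {p₆} (0≤+ {p₁} {p₂} 0≤p₁ 0≤p₂)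
        (0≤- {s} {X + D + r} s≤)) (0≤- {X} {Y} X≤Y)) (0≤+ {h} {h} 0≤h 0≤h))
      (solve 7 (λ h X D Y s r ε → :- (h :+ Y :- s) :+ ((con ½ :* ε :- (D :+ h)) :+ (con ½ :* ε :- r) :+
        (X :+ D :+ r :- s) :+ (Y :- X) :+ (h :+ h)) := ε)
        refl h X D Y s r ε))
    where
    p₁ p₂ p₃ p₄ p₅ p₆ p₇ gap₁ gap₂ : ℚ
    p₁ = ½ * ε - (D + h)
    p₂ = ½ * ε - r
    p₃ = X + D + r - sₙ
    p₄ = sₙ - Y
    p₅ = s - (X + D)
    p₆ = X + D + r - s
    p₇ = Y - X
    gap₁ = p₁ + p₂ + p₃ + p₄ + p₅ + D
    gap₂ = p₁ + p₂ + p₆ + p₇ + (h + h)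
    0≤p₁ : 0ℚ ≤ p₁
    0≤p₁ = 0≤- {D + h} {½ * ε} Dh≤
    0≤p₂ : 0ℚ ≤ p₂
    0≤p₂ = 0≤- {r} {½ * ε} r≤

  density-limit : ∀ ε → 0ℚ < ε → ∃ λ N → ∃ λ T → ∀ n t → N ℕ.≤ n → T ℕ.≤ t →
                  ∣ fullCount n /2^ n - S t ∣ ≤ ε
  -- `n ≥ T` puts the first `T` terms inside the density and `S n` within the tail bound.
  density-limit ε 0<ε = N ℕ.⊔ T , T , bound
    where
    small-tail : ∃ λ N → ∀ k → N ℕ.≤ k → a (2 ℕ.+ k) + a (2 ℕ.+ k) ≤ ½ * ε
    small-tail = vanishes-+ {λ k → a (2 ℕ.+ k)} {λ k → a (2 ℕ.+ k)} a-vanishes a-vanishes (½ * ε) (0<½* ε 0<ε)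
    T₀ T N : ℕ
    T₀ = proj₁ small-tail
    T  = 2 ℕ.+ T₀
    small-defect : ∃ λ N → ∀ n → N ℕ.≤ n → ∑ T (d n) + half^ n ≤ ½ * ε
    small-defect = vanishes-+ {λ n → ∑ T (d n)} {half^}
      (vanishes-∑ T {λ t n → d n t} d-vanishes) half^-vanishes (½ * ε) (0<½* ε 0<ε)
    N = proj₁ small-defect
    r : ℚ
    r = a T + a T
    S-T : ∀ n → ∑ T (x n) + ∑ T (d n) ≡ S T
    S-T n = ∑x+∑d n T
    S≤ : ∀ n t → T ℕ.≤ t → S t ≤ ∑ T (x n) + ∑ T (d n) + r
    S≤ n t T≤t = subst (λ y → S t ≤ y + r) (sym (S-T n)) (S-tail T₀ t T≤t)
    bound : ∀ n t → N ℕ.⊔ T ℕ.≤ n → T ℕ.≤ t → ∣ fullCount n /2^ n - S t ∣ ≤ ε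
    bound n t n≥ t≥ = subst (λ y → ∣ y - S t ∣ ≤ ε) (sym (density n))
      (squeeze (half^ n) (∑ T (x n)) (∑ T (d n)) (∑ n (x n)) (S t) (S n) r ε
        (0≤half^ n) (0≤∑ T {d n} (0≤d n))
        (subst (λ m → ∑ T (x n) ≤ ∑ m (x n)) (ℕₚ.m∸n+n≡m T≤n) (∑-extend T (n ℕ.∸ T) {x n} (0≤x n)))
        (subst (∑ n (x n) ≤_) (∑x+∑d n n)
          (≤-by {∑ n (x n)} {∑ n (x n) + ∑ n (d n)} (∑ n (d n)) (0≤∑ n {d n} (0≤d n)) refl))
        (S≤ n n T≤n)
        (subst (_≤ S t) (sym (S-T n)) (S-mono T t t≥))
        (S≤ n t t≥)
        (proj₂ small-defect n (ℕₚ.m⊔n≤o⇒m≤o N T n≥))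
        (proj₂ small-tail T₀ ℕₚ.≤-refl))
      where
      T≤n : T ℕ.≤ n
      T≤n = ℕₚ.m⊔n≤o⇒n≤o N T n≥

open Cycles using (fullCount; full-count; count-unique)
open Limits using (density-limit)
open import Data.Nat using (ℕ; _≥_; _^_)
open import Data.Rational using (ℚ; _-_; _≤_; _<_; ∣_∣; 0ℚ)
import Data.Nat as ℕ
import Data.Nat.Properties as ℕₚ

theorem3p6 : (M : ℕ → ℕ)
    → (∀ n → n ≥ 1 → CountUpToRot n (M n))
    → ∀ (ε : ℚ) → 0ℚ < ε
    → Σ ℕ λ N → Σ ℕ λ T → ∀ n t → n ≥ N → t ≥ T
    → ∣ M n /2^ n - S t ∣ ≤ ε
theorem3p6 M counts ε 0<ε =
  let (N , T , bound) = density-limit ε 0<ε in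
  -- The successor excludes period 0, for which `counts` gives nothing.
  ℕ.suc N , T , λ { n@(ℕ.suc n-1) t n≥ t≥ →
    subst (λ m → ∣ m /2^ n - S t ∣ ≤ ε)
          (count-unique (full-count n-1) (counts n (ℕ.s≤s ℕ.z≤n)))
          (bound n t (ℕₚ.<⇒≤ n≥) t≥) }
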